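{- Let $t=q_1^{f_1}q_2^{f_2}\cdots q_r^{f_r}$ with $r\ge 2$, $q_1,\dots,q_r$ distinct odd primes and $f_i\ge 1$, and let $p$ be a prime different from all the $q_i$. Let $T_t$ be the $t$-th Chebyshev polynomial. For $1\le i\le r$ let $\delta_i=\operatorname{ord}_{q_i}(p)$ and $\mu_i=v_{q_i}(p^{\delta_i}-1)$, and let $\Delta=\operatorname{lcm}\{\delta_i\}_{1\le i\le r}$. Fix a positive integer $\delta$ and a tuple $\nu=\langle\nu_1,\dots,\nu_r\rangle$ of non-negative integers such that infinitely many positive integers $n$ satisfy $\gcd(\Delta,n)=\delta$ and $v_{q_i}(n)=\nu_i$ for all $i$. Then there are disjoint subsets $I,J\subseteq\{1,2,\dots,r\}$ such that $$\lim_{\substack{n \to \infty\\ \gcd(\Delta,n)=\delta\\ v_{q_i}(n)=\nu_i\ (1\le i\le r)}}\frac{\#\operatorname{Per}\left(T_t, \mathbb{F}_{p^n}\right)}{p^n}=\frac{Q_I+Q_J}{2Q_IQ_J},$$ where $$Q_I=\prod_{i\in I}q_i^{\mu_i+\nu_i}\quad\text{and}\quad Q_J=\prod_{j\in J}q_j^{\mu_j+\nu_j}.$$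
   Context: For a polynomial $\phi$ with integer coefficients (reduced mod $p$) and a field $K$ of characteristic $p$, $\operatorname{Per}(\phi,K)=\{\alpha\in K : \phi^m(\alpha)=\alpha \text{ for some } m>0\}$, where $\phi^m$ is the $m$-th iterate of $\phi$ under composition. $\mathbb{F}_{p^n}$ is the field with $p^n$ elements. $v_q$ denotes $q$-adic valuation, and $\operatorname{ord}_q(p)$ is the smallest positive integer $k$ with $q\mid p^k-1$. The Chebyshev polynomials $T_d\in\mathbb{Z}[w]$ are defined by $T_0(w)=2$, $T_1(w)=w$, $T_d(w)=wT_{d-1}(w)-T_{d-2}(w)$ for $d\ge 2$; equivalently $T_d(z+z^{ -1})=z^d+z^{ -d}$. An empty product equals $1$. The limit is taken as $n\to\infty$ through the positive integers $n$ satisfying the conditions displayed under the limit sign. -}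

module Defs where

open import Algebra.Bundles using (CommutativeRing)
open import Data.Fin.Base as Fin using (Fin; toℕ; fromℕ<)
import Data.Fin.Properties as Fin
open import Data.Fin.Subset using (Subset)
open import Data.Fin.Subset.Properties using (_∈?_)
open import Data.Integer.Base as ℤ using (ℤ; +_; -[1+_]; 0ℤ; 1ℤ)
open import Data.List.Base using (List; []; _∷_; map; filter; foldr; tabulate; allFin; length)
open import Data.List.Relation.Unary.All using (universal)
open import Data.List.Relation.Unary.All.Properties using (map⁺)
open import Data.Nat.Base as ℕ using (ℕ; zero; suc; _^_; _≤_; _<_; NonZero; s≤s; z≤n)
open import Data.Nat.Divisibility using (_∣_)
open import Data.Nat.LCM using (lcm)
open import Data.Nat.ListAction using (product)
open import Data.Nat.ListAction.Properties using (product≢0)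
open import Data.Nat.Primality using (Prime; prime⇒nonZero)
import Data.Nat.Properties as ℕ
open import Data.Product.Base using (∃-syntax; _×_; _,_)
open import Data.Rational.Base as ℚ using (ℚ; 0ℚ; ∣_∣)
open import Function.Bundles using (Func; Inverse; _⟨$⟩_)
import Function.Endo.Setoid as Endo
open import Level using (_⊔_) renaming (suc to lsuc)
open import Relation.Binary.Definitions using (Decidable)
open import Relation.Binary.PropositionalEquality as ≡ using (_≡_)
open import Relation.Nullary using (¬_; Dec)
open import Relation.Nullary.Decidable using (map′)
open import Relation.Unary using (Pred)

-- Coefficients, constant term first; trailing zeros are allowed.
Poly : Set
Poly = List ℤ

infixl 6 _⊖_
_⊖_ : Poly → Poly → Poly
[]      ⊖ ψ       = map ℤ.-_ ψ
(a ∷ φ) ⊖ []      = a ∷ φ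
(a ∷ φ) ⊖ (b ∷ ψ) = (a ℤ.- b) ∷ (φ ⊖ ψ)

infixr 7 w·_
w·_ : Poly → Poly
w· φ = 0ℤ ∷ φ

Chebyshev : ℕ → Poly
Chebyshev 0             = + 2 ∷ []
Chebyshev 1             = 0ℤ ∷ 1ℤ ∷ []
Chebyshev (suc (suc d)) = w· Chebyshev (suc d) ⊖ Chebyshev d

-- The classical definition.  For the finite fields considered here equality
-- is decidable, so a separate apartness relation would carry no information.
record Field c ℓ : Set (lsuc (c ⊔ ℓ)) where
  field
    commutativeRing : CommutativeRing c ℓ

  open CommutativeRing commutativeRing public

  field
    1≉0     : ¬ 1# ≈ 0#
    inverse : ∀ x → ¬ x ≈ 0# → ∃[ y ] x * y ≈ 1#

record FiniteField c ℓ (N : ℕ) : Set (lsuc (c ⊔ ℓ)) where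
  field
    baseField   : Field c ℓ
    enumeration : Inverse (Field.setoid baseField) (≡.setoid (Fin N))

module _ {c ℓ} (K : Field c ℓ) where

  open Field K
  open import Algebra.Definitions.RawMonoid +-rawMonoid
    using () renaming (_×_ to _·_)
  open Endo setoid using () renaming (Endo to Self; _^_ to _^^_)

  -- The unique ring homomorphism ℤ → K; in characteristic p this is
  -- reduction mod p.
  fromℤ : ℤ → Carrier
  fromℤ (+ n)    = n · 1#
  fromℤ -[1+ n ] = - (suc n · 1#)

  eval : Poly → Carrier → Carrier
  eval []      x = 0#
  eval (a ∷ φ) x = fromℤ a + x * eval φ x

  eval-cong : ∀ φ {x y} → x ≈ y → eval φ x ≈ eval φ y
  eval-cong []      x≈y = refl
  eval-cong (a ∷ φ) x≈y = +-congˡ (*-cong x≈y (eval-cong φ x≈y))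

  polyMap : Poly → Self
  polyMap φ = record { to = eval φ ; cong = eval-cong φ }

  Per : Poly → Carrier → Set ℓ
  Per φ α = ∃[ m ] 0 < m × (polyMap φ ^^ m) ⟨$⟩ α ≈ α

module _ {c ℓ} {N : ℕ} (F : FiniteField c ℓ N) where

  open FiniteField F
  open Field baseField
  open Inverse enumeration using (to; from; to-cong; strictlyInverseʳ)
  open Endo setoid using (^-homo) renaming (Endo to Self; _^_ to _^^_)
  open import Relation.Binary.Reasoning.Setoid setoid

  to-injective : ∀ {x y} → to x ≡ to y → x ≈ y
  to-injective {x} {y} eq = begin
    x           ≈⟨ strictlyInverseʳ x ⟨
    from (to x) ≡⟨ ≡.cong from eq ⟩
    from (to y) ≈⟨ strictlyInverseʳ y ⟩
    y           ∎

  _≈?_ : Decidable _≈_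
  x ≈? y = map′ to-injective to-cong (to x Fin.≟ to y)

  period-multiple : ∀ (f : Self) α m → (f ^^ m) ⟨$⟩ α ≈ α →
                    ∀ k → (f ^^ (k ℕ.* m)) ⟨$⟩ α ≈ α
  period-multiple f α m fᵐα≈α zero    = refl
  period-multiple f α m fᵐα≈α (suc k) = begin
    (f ^^ (m ℕ.+ k ℕ.* m)) ⟨$⟩ α          ≈⟨ ^-homo f m (k ℕ.* m) α ⟩
    (f ^^ (k ℕ.* m)) ⟨$⟩ ((f ^^ m) ⟨$⟩ α) ≈⟨ Func.cong (f ^^ (k ℕ.* m)) fᵐα≈α ⟩
    (f ^^ (k ℕ.* m)) ⟨$⟩ α                ≈⟨ period-multiple f α m fᵐα≈α k ⟩
    α                                     ∎

  -- By the pigeonhole principle, every periodic point has a period in 1, …, N.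
  bounded-period : ∀ (f : Self) α m → 0 < m → (f ^^ m) ⟨$⟩ α ≈ α →
                   ∃[ k ] (f ^^ suc (toℕ {N} k)) ⟨$⟩ α ≈ α
  bounded-period f α m@(suc m-1) _ fᵐα≈α
    with i , j , i<j , eq ← Fin.pigeonhole (ℕ.n<1+n N) (λ i → to ((f ^^ toℕ i) ⟨$⟩ α))
    with d , 1+i+d≡j ← ℕ.m≤n⇒∃[o]m+o≡n i<j
    = fromℕ< d<N , (begin
    (f ^^ suc (toℕ (fromℕ< d<N))) ⟨$⟩ α       ≡⟨ ≡.cong (λ n → (f ^^ suc n) ⟨$⟩ α) (Fin.toℕ-fromℕ< d<N) ⟩
    (f ^^ suc d) ⟨$⟩ α                        ≈⟨ Func.cong (f ^^ suc d) fⁱᵐα≈α ⟨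
    (f ^^ suc d) ⟨$⟩ ((f ^^ (I ℕ.* m)) ⟨$⟩ α) ≈⟨ ^-homo f (I ℕ.* m) (suc d) α ⟨
    (f ^^ (I ℕ.* m ℕ.+ suc d)) ⟨$⟩ α          ≡⟨ ≡.cong (λ n → (f ^^ n) ⟨$⟩ α) shift ⟩
    (f ^^ (J ℕ.+ e)) ⟨$⟩ α                    ≈⟨ ^-homo f J e α ⟩
    (f ^^ e) ⟨$⟩ ((f ^^ J) ⟨$⟩ α)             ≈⟨ Func.cong (f ^^ e) (to-injective eq) ⟨
    (f ^^ e) ⟨$⟩ ((f ^^ I) ⟨$⟩ α)             ≈⟨ ^-homo f I e α ⟨
    (f ^^ (I ℕ.+ e)) ⟨$⟩ α                    ≡⟨ ≡.cong (λ n → (f ^^ n) ⟨$⟩ α) I+e≡I*m ⟩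
    (f ^^ (I ℕ.* m)) ⟨$⟩ α                    ≈⟨ fⁱᵐα≈α ⟩
    α                                         ∎)
    where
    I = toℕ i
    J = toℕ j
    e = I ℕ.* m ℕ.∸ I
    fⁱᵐα≈α = period-multiple f α m fᵐα≈α I

    I+e≡I*m : I ℕ.+ e ≡ I ℕ.* m
    I+e≡I*m = ℕ.m+[n∸m]≡n (ℕ.m≤m*n I m)

    d<N : d < N
    d<N = ℕ.≤-trans (ℕ.≤-trans (s≤s (ℕ.m≤n+m d I)) (ℕ.≤-reflexive 1+i+d≡j))
                    (ℕ.s≤s⁻¹ (Fin.toℕ<n j))

    shift : I ℕ.* m ℕ.+ suc d ≡ J ℕ.+ e
    shift = ≡R.begin
      I ℕ.* m ℕ.+ suc d     ≡R.≡⟨ ≡.cong (ℕ._+ suc d) (≡.sym I+e≡I*m) ⟩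
      I ℕ.+ e ℕ.+ suc d     ≡R.≡⟨ ℕ.+-assoc I e (suc d) ⟩
      I ℕ.+ (e ℕ.+ suc d)   ≡R.≡⟨ ≡.cong (I ℕ.+_) (ℕ.+-comm e (suc d)) ⟩
      I ℕ.+ (suc d ℕ.+ e)   ≡R.≡⟨ ≡.sym (ℕ.+-assoc I (suc d) e) ⟩
      I ℕ.+ suc d ℕ.+ e     ≡R.≡⟨ ≡.cong (ℕ._+ e) (ℕ.+-suc I d) ⟩
      suc I ℕ.+ d ℕ.+ e     ≡R.≡⟨ ≡.cong (ℕ._+ e) 1+i+d≡j ⟩
      J ℕ.+ e               ≡R.∎
      where module ≡R = ≡.≡-Reasoning

  Per? : ∀ φ α → Dec (Per baseField φ α)
  Per? φ α = map′ (λ (k , eq) → suc (toℕ k) , s≤s z≤n , eq)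
                  (λ (m , m>0 , eq) → bounded-period (polyMap baseField φ) α m m>0 eq)
                  (Fin.any? λ (k : Fin N) → ((polyMap baseField φ ^^ suc (toℕ k)) ⟨$⟩ α) ≈? α)

  #Per : Poly → ℕ
  #Per φ = length (filter (Per? φ) (map from (allFin N)))

  perDensity : Poly → ℚ
  perDensity φ = + #Per φ ℚ./ N
    where instance _ = Fin.nonZeroIndex (to 0#)

-- k is the q-adic valuation of n; no k qualifies when n = 0.
IsValuation : (q n k : ℕ) → Set
IsValuation q n k = q ^ k ∣ n × ¬ (q ^ suc k ∣ n)

-- k is the multiplicative order of p modulo q.
IsOrd : (q p k : ℕ) → Set
IsOrd q p k = 0 < k × q ∣ p ^ k ℕ.∸ 1
            × (∀ j → 0 < j → q ∣ p ^ j ℕ.∸ 1 → k ≤ j)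

module _ {r : ℕ} where

  ∏ : (Fin r → ℕ) → ℕ
  ∏ f = product (tabulate f)

  Lcm : (Fin r → ℕ) → ℕ
  Lcm f = foldr lcm 1 (tabulate f)

  ∏[_] : Subset r → (Fin r → ℕ) → ℕ
  ∏[ S ] f = product (map f (filter (_∈? S) (allFin r)))

  ∏-primePowers≢0 : ∀ {q : Fin r → ℕ} → (∀ i → Prime (q i)) →
                    ∀ S (e : Fin r → ℕ) → NonZero (∏[ S ] λ i → q i ^ e i)
  ∏-primePowers≢0 {q} q-prime S e = product≢0 (map⁺ (universal
    (λ i → ℕ.m^n≢0 (q i) (e i) {{prime⇒nonZero (q-prime i)}})
    (filter (_∈? S) (allFin r))))

  mean-denominator≢0 : ∀ {q : Fin r → ℕ} → (∀ i → Prime (q i)) → ∀ S S′ (e : Fin r → ℕ) →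
    NonZero (2 ℕ.* (∏[ S ] λ i → q i ^ e i) ℕ.* (∏[ S′ ] λ i → q i ^ e i))
  mean-denominator≢0 q-prime S S′ e =
    ℕ.m*n≢0 _ _ {{ℕ.m*n≢0 2 _ {{_}} {{∏-primePowers≢0 q-prime S e}}}} {{∏-primePowers≢0 q-prime S′ e}}

-- a n → L as n → ∞ through the positive integers n satisfying P.
LimitAlong : ∀ {ℓ} → Pred ℕ ℓ → (∀ n → .{{NonZero n}} → ℚ) → ℚ → Set ℓ
LimitAlong P a L = ∀ ε → 0ℚ ℚ.< ε →
  ∃[ N ] (∀ n → .{{_ : NonZero n}} → N ≤ n → P n → ∣ a n ℚ.- L ∣ ℚ.< ε)

{-# OPTIONS --safe #-}

-- Write x = z + z⁻¹, so that Tₘ(x) = zᵐ + z⁻ᵐ, and let N = pⁿ.  Frobenius gives T_N(x) = x for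
-- x ∈ 𝔽_N, that is, T_{N−1}(x) = 2 or T_{N+1}(x) = 2.  Let A and B be the largest divisors of
-- N − 1 and N + 1 that are prime to t.  Then x is periodic under T_t iff T_A(x) = 2 or
-- T_B(x) = 2.  The equation Tₘ(x) = 2 has at most m/2 + 1 solutions, because Tₘ − 2 is
-- essentially a square; as all of 𝔽_N satisfies the equation for N − 1 or for N + 1, these
-- bounds are sharp up to O(1) for m = N ± 1, and then also for m = A, B since the fibres of
-- T_{(N−1)/A} and T_{(N+1)/B} are no larger than their degrees.  So #Per = (A + B)/2 + O(1).
-- Lifting the exponent gives (N − 1)/A = Q_I and (N + 1)/B = Q_J, where I = {i : δᵢ ∣ δ} and
-- J = {i : δᵢ ∣ 2δ, δᵢ ∤ δ}.

module Submission where

open import Defs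
import Algebra.Construct.DirectProduct as DirectProduct
import Algebra.Properties.CommutativeMonoid.Sum
import Algebra.Properties.Semiring.Exp
import Algebra.Properties.Semiring.Mult
import Algebra.Solver.Ring
import Algebra.Solver.Ring.NaturalCoefficients.Default
open import Algebra.Bundles using (CommutativeMonoid; CommutativeSemiring)
open import Algebra.Solver.Ring.AlmostCommutativeRing using (fromCommutativeRing; _-Raw-AlmostCommutative⟶_)
open import Algebra.Structures.Biased using (IsCommutativeSemiringˡ)
open import Data.Fin.Base as Fin using (Fin; toℕ; punchIn; punchOut)
open import Data.Fin.Permutation using (Permutation; permutation; _⟨$⟩ʳ_)
import Data.Fin.Properties as Fin
open import Data.Fin.Subset using (Subset; Empty; _∩_; _∈_; _∉_)
open import Data.Fin.Subset.Properties using (_∈?_; x∈p∩q⁻)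
open import Data.Integer.Base as ℤ using (ℤ; +_; -[1+_]; _◃_; 0ℤ; 1ℤ)
import Data.Integer.Properties as ℤ
open import Data.List.Base using (List; []; _∷_; allFin; filter; foldr; length; map)
import Data.List.Membership.Propositional as Membershipₚ
open import Data.List.Membership.Propositional.Properties using (∈-allFin; ∈-filter⁺; ∈-map⁺; ∈-tabulate⁺)
import Data.List.Membership.Setoid as Membership
import Data.List.Membership.Setoid.Properties as Membershipₛ
import Data.List.Properties as List
open import Data.List.Relation.Unary.All as All using (All; []; _∷_)
import Data.List.Relation.Unary.All.Properties as All
open import Data.List.Relation.Unary.AllPairs using ([]; _∷_)
open import Data.List.Relation.Unary.Any as Any using (any?; here; there)
import Data.List.Relation.Unary.Unique.Propositional as Propositional
import Data.List.Relation.Unary.Unique.Propositional.Properties as Uniqueₚ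
import Data.List.Relation.Unary.Unique.Setoid as UniqueSetoid
import Data.List.Relation.Unary.Unique.Setoid.Properties as Unique
open import Data.Maybe.Base as Maybe using (Maybe)
open import Data.Nat.Base as ℕ using (ℕ; zero; suc; NonZero; z≤n; s≤s; _!)
open import Data.Nat.Combinatorics renaming (_C_ to _choose_) using (nCn≡1; nCk≡n!/k![n-k]!; k![n∸k]!∣n!)
open import Data.Nat.Coprimality as Coprimality using (Coprime; coprime-divisor)
open import Data.Nat.Divisibility
open import Data.Nat.DivMod using (m≡m%n+[m/n]*n; m%n<n; m/n*n≡m)
open import Data.Nat.GCD using (gcd; gcd-GCD; gcd[m,n]∣m; gcd[m,n]∣n; gcd-greatest; c*gcd[m,n]≡gcd[cm,cn]; module Bézout)
open import Data.Nat.InfinitelyOften using (Inf)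
open import Data.Nat.LCM using (lcm; m∣lcm[m,n]; n∣lcm[m,n])
open import Data.Nat.ListAction using (product)
open import Data.Nat.ListAction.Properties using (∈⇒∣product; product≢0)
open import Data.Nat.Primality
  using (Prime; prime[2]; ¬prime[0]; euclidsLemma; prime⇒irreducible; prime⇒nonTrivial; prime⇒nonZero)
import Data.Nat.Properties as ℕ
open import Data.Nat.Tactic.RingSolver using (solve-∀)
open import Data.Product.Base using (∃-syntax; _×_; _,_; proj₁; proj₂)
open import Data.Rational.Base as ℚ using (mkℚ; 0ℚ; toℚᵘ; fromℚᵘ; _/_)
import Data.Rational.Properties as ℚ
open import Data.Rational.Unnormalised.Base as ℚᵘ using (mkℚᵘ)
import Data.Rational.Unnormalised.Properties as ℚᵘ
import Data.Sign.Base as Sign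
open import Data.Sum.Base as Sum using (_⊎_; inj₁; inj₂; [_,_]′)
open import Data.Unit.Base using (⊤)
import Data.Vec.Base as Vec
open import Data.Vec.Functional using (Vector; init; last; removeAt; tail)
open import Data.Vec.Properties using (lookup∘tabulate; []=⇒lookup; lookup⇒[]=)
open import Function.Base using (_∘_; id)
open import Function.Bundles using (Inverse; _⟨$⟩_)
open import Function.Definitions using (Injective)
import Function.Endo.Setoid as Endo
open import Level using (Level; _⊔_)
import Relation.Binary.Definitions as Binary
open import Relation.Binary.PropositionalEquality as ≡ using (_≡_; _≢_)
open import Relation.Nullary using (¬_; Dec; yes; no; does; contradiction; ¬?; _×-dec_)
open import Relation.Nullary.Decidable using (dec⇒maybe; dec-true)
open import Relation.Unary using (Pred; Decidable)

-- The natural home of the argument is the pair of cyclic groups of orders N - 1 and N + 1 in which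
-- z lies, but z may exist only in a quadratic extension of 𝔽_N. Statements about the order of z are
-- therefore replaced by statements about the set of m with Tₘ(x) = 2, which behaves like the set of
-- multiples of that order: it is closed under multiples, differences and gcds. Two identities carry
-- this, the product formula `T-*` and its consequence `T-difference²`. Both hold in every
-- characteristic, so p = 2 gets no separate treatment. The element z itself is constructed only to
-- apply Frobenius to z + z⁻¹. Exact solution counts would call for cyclicity and for distinctions
-- of parity. Upper bounds are enough: those for N - 1 and N + 1 add up to N + O(1), while the two
-- solution sets together cover N points, so neither can fall short of its bound by more than a
-- constant.

module IntegerImage {c ℓ} (K : Field c ℓ) where

  open Field K hiding (zero)
  open import Algebra.Definitions.RawMonoid +-rawMonoid
    using () renaming (_×_ to _·_)
  open import Algebra.Properties.Semiring.Mult semiring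
    using (×-homo-+; ×1-homo-*)
  open import Algebra.Properties.Ring ring
    using (-‿involutive; -0#≈0#; -‿distribˡ-*; -‿distribʳ-*; -‿+-comm)
  open import Relation.Binary.Reasoning.Setoid setoid
  open import Algebra.Properties.CommutativeSemigroup +-commutativeSemigroup
    using (interchange)

  private
    ι : ℤ → Carrier
    ι = fromℤ K

    a-[0]≈a : ∀ a → a + - 0# ≈ a
    a-[0]≈a a = trans (+-congˡ -0#≈0#) (+-identityʳ a)

  fromℤ-⊖ : ∀ m n → ι (m ℤ.⊖ n) ≈ m · 1# + - (n · 1#)
  fromℤ-⊖ m       zero    = sym (a-[0]≈a _)
  fromℤ-⊖ zero    (suc n) = sym (+-identityˡ _)
  fromℤ-⊖ (suc m) (suc n) = begin
    ι (suc m ℤ.⊖ suc n)                  ≡⟨ ≡.cong ι (ℤ.[1+m]⊖[1+n]≡m⊖n m n) ⟩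
    ι (m ℤ.⊖ n)                          ≈⟨ fromℤ-⊖ m n ⟩
    m · 1# + - (n · 1#)                  ≈⟨ +-identityˡ _ ⟨
    0# + (m · 1# + - (n · 1#))           ≈⟨ +-congʳ (-‿inverseʳ 1#) ⟨
    1# + - 1# + (m · 1# + - (n · 1#))    ≈⟨ interchange 1# (- 1#) (m · 1#) (- (n · 1#)) ⟩
    suc m · 1# + (- 1# + - (n · 1#))     ≈⟨ +-congˡ (-‿+-comm 1# (n · 1#)) ⟩
    suc m · 1# + - (suc n · 1#)          ∎

  fromℤ-+ : ∀ i j → ι (i ℤ.+ j) ≈ ι i + ι j
  fromℤ-+ (+ m)    (+ n)    = ×-homo-+ 1# m n
  fromℤ-+ (+ m)    -[1+ n ] = fromℤ-⊖ m (suc n)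
  fromℤ-+ -[1+ m ] (+ n)    = trans (fromℤ-⊖ n (suc m)) (+-comm _ _)
  fromℤ-+ -[1+ m ] -[1+ n ] = begin
    - (suc (suc (m ℕ.+ n)) · 1#)         ≡⟨ ≡.cong (λ k → - (suc k · 1#)) (ℕ.+-suc m n) ⟨
    - ((suc m ℕ.+ suc n) · 1#)           ≈⟨ -‿cong (×-homo-+ 1# (suc m) (suc n)) ⟩
    - (suc m · 1# + suc n · 1#)          ≈⟨ -‿+-comm _ _ ⟨
    - (suc m · 1#) + - (suc n · 1#)      ∎

  fromℤ-neg : ∀ i → ι (ℤ.- i) ≈ - ι i
  fromℤ-neg (+ zero)  = sym -0#≈0#
  fromℤ-neg (+ suc n) = refl
  fromℤ-neg -[1+ n ]  = sym (-‿involutive _)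

  private
    -- Multiplication in ℤ assembles a sign and an absolute value with `◃`, which forgets the sign
    -- at 0; hence the separate case `zero`.
    +◃ : ∀ n → ι (Sign.+ ◃ n) ≈ n · 1#
    +◃ zero    = refl
    +◃ (suc n) = refl

    -◃ : ∀ n → ι (Sign.- ◃ n) ≈ - (n · 1#)
    -◃ zero    = sym -0#≈0#
    -◃ (suc n) = refl

  fromℤ-* : ∀ i j → ι (i ℤ.* j) ≈ ι i * ι j
  fromℤ-* (+ m)    (+ n)    = trans (+◃ (m ℕ.* n)) (×1-homo-* m n)
  fromℤ-* (+ m)    -[1+ n ] = begin
    ι (Sign.- ◃ (m ℕ.* suc n))      ≈⟨ -◃ (m ℕ.* suc n) ⟩
    - ((m ℕ.* suc n) · 1#)          ≈⟨ -‿cong (×1-homo-* m (suc n)) ⟩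
    - (m · 1# * suc n · 1#)         ≈⟨ -‿distribʳ-* _ _ ⟩
    m · 1# * - (suc n · 1#)         ∎
  fromℤ-* -[1+ m ] (+ n)    = begin
    ι (Sign.- ◃ (suc m ℕ.* n))      ≈⟨ -◃ (suc m ℕ.* n) ⟩
    - ((suc m ℕ.* n) · 1#)          ≈⟨ -‿cong (×1-homo-* (suc m) n) ⟩
    - (suc m · 1# * n · 1#)         ≈⟨ -‿distribˡ-* _ _ ⟩
    - (suc m · 1#) * n · 1#         ∎
  fromℤ-* -[1+ m ] -[1+ n ] = begin
    (suc m ℕ.* suc n) · 1#                  ≈⟨ ×1-homo-* (suc m) (suc n) ⟩
    suc m · 1# * suc n · 1#                 ≈⟨ -‿involutive _ ⟨
    - (- (suc m · 1# * suc n · 1#))         ≈⟨ -‿cong (-‿distribˡ-* _ _) ⟩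
    - (- (suc m · 1#) * suc n · 1#)         ≈⟨ -‿distribʳ-* _ _ ⟩
    - (suc m · 1#) * - (suc n · 1#)         ∎

  morphism : ℤ.+-*-rawRing -Raw-AlmostCommutative⟶ fromCommutativeRing commutativeRing
  morphism = record
    { ⟦_⟧    = ι
    ; +-homo = fromℤ-+
    ; *-homo = fromℤ-*
    ; -‿homo = fromℤ-neg
    ; 0-homo = refl
    ; 1-homo = +-identityʳ 1#
    }

  private
    -- Coefficients are compared in ℤ before they are mapped to K, so the identities that the solver
    -- finds hold in every characteristic.
    equal-images : ∀ i j → Maybe (ι i ≈ ι j)
    equal-images i j = Maybe.map (λ i≡j → reflexive (≡.cong ι i≡j)) (dec⇒maybe (i ℤ.≟ j))

  module Solver =
    Algebra.Solver.Ring ℤ.+-*-rawRing (fromCommutativeRing commutativeRing) morphism equal-images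

-- Chebyshev polynomials over a field: identities and numbers of solutions

halve : ∀ n → ∃[ k ] ∃[ j ] j ℕ.≤ 1 × suc n ≡ k ℕ.+ (k ℕ.+ suc j)
halve zero    = 0 , 0 , z≤n , ≡.refl
halve (suc n) with halve n
... | k , zero     , _ , eq = k , 1 , s≤s z≤n , ≡.trans (≡.cong suc eq) (step k)
  where
  step : ∀ k → suc (k ℕ.+ (k ℕ.+ 1)) ≡ k ℕ.+ (k ℕ.+ 2)
  step = solve-∀
... | k , suc zero , _ , eq = suc k , 0 , z≤n , ≡.trans (≡.cong suc eq) (step k)
  where
  step : ∀ k → suc (k ℕ.+ (k ℕ.+ 2)) ≡ suc k ℕ.+ (suc k ℕ.+ 1)
  step = solve-∀
... | k , suc (suc _) , s≤s () , _

halve-bound : ∀ {l n j k} → j ℕ.≤ 1 → n ≡ k ℕ.+ (k ℕ.+ suc j) → l ℕ.≤ suc j ℕ.+ k → 2 ℕ.* l ℕ.≤ 2 ℕ.+ n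
halve-bound {l} {n} {j} {k} j≤1 n≡ l≤ = begin
  2 ℕ.* l                            ≤⟨ ℕ.*-monoʳ-≤ 2 l≤ ⟩
  2 ℕ.* (suc j ℕ.+ k)                ≡⟨ arrange j k ⟩
  suc j ℕ.+ (k ℕ.+ (k ℕ.+ suc j))    ≤⟨ ℕ.+-mono-≤ (s≤s j≤1) (ℕ.≤-reflexive (≡.sym n≡)) ⟩
  2 ℕ.+ n                            ∎
  where
  open ℕ.≤-Reasoning
  arrange : ∀ j k → 2 ℕ.* (suc j ℕ.+ k) ≡ suc j ℕ.+ (k ℕ.+ (k ℕ.+ suc j))
  arrange = solve-∀

module DecidableField {c ℓ} (K : Field c ℓ) (_≟_ : Binary.Decidable (Field._≈_ K)) where

  open Field K hiding (zero)
  open IntegerImage K using (module Solver)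
  open Solver
  open import Relation.Binary.Reasoning.Setoid setoid

  ≈⇒-≈0 : ∀ {x y} → x ≈ y → x - y ≈ 0#
  ≈⇒-≈0 x≈y = trans (+-congʳ x≈y) (-‿inverseʳ _)

  -≈0⇒≈ : ∀ {x y} → x - y ≈ 0# → x ≈ y
  -≈0⇒≈ {x} {y} x-y≈0 = begin
    x           ≈⟨ solve 2 (λ x y → x := x :- y :+ y) refl x y ⟩
    x - y + y   ≈⟨ +-congʳ x-y≈0 ⟩
    0# + y      ≈⟨ +-identityˡ y ⟩
    y           ∎

  *-cancelˡ-nonZero : ∀ {x y z} → ¬ x ≈ 0# → x * y ≈ x * z → y ≈ z
  *-cancelˡ-nonZero {x} {y} {z} x≉0 xy≈xz with w , xw≈1 ← inverse x x≉0 = begin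
    y             ≈⟨ *-identityˡ y ⟨
    1# * y        ≈⟨ *-congʳ xw≈1 ⟨
    x * w * y     ≈⟨ solve 3 (λ x w y → x :* w :* y := w :* (x :* y)) refl x w y ⟩
    w * (x * y)   ≈⟨ *-congˡ xy≈xz ⟩
    w * (x * z)   ≈⟨ solve 3 (λ x w y → x :* w :* y := w :* (x :* y)) refl x w z ⟨
    x * w * z     ≈⟨ *-congʳ xw≈1 ⟩
    1# * z        ≈⟨ *-identityˡ z ⟩
    z             ∎

  integral : ∀ x y → x * y ≈ 0# → x ≈ 0# ⊎ y ≈ 0#
  integral x y xy≈0 with x ≟ 0#
  ... | yes x≈0 = inj₁ x≈0
  ... | no  x≉0 = inj₂ (*-cancelˡ-nonZero x≉0 (trans xy≈0 (sym (zeroʳ x))))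

  square≈0 : ∀ x → x * x ≈ 0# → x ≈ 0#
  square≈0 x xx≈0 = [ id , id ]′ (integral x x xx≈0)

  two : Carrier
  two = fromℤ K (+ 2)

  T : ℕ → Carrier → Carrier
  T n = eval K (Chebyshev n)

  eval-neg : ∀ φ x → eval K (map ℤ.-_ φ) x ≈ - eval K φ x
  eval-neg []      x = solve 0 (con 0ℤ := :- con 0ℤ) refl
  eval-neg (a ∷ φ) x = begin
    fromℤ K (ℤ.- a) + x * eval K (map ℤ.-_ φ) x  ≈⟨ +-cong (IntegerImage.fromℤ-neg K a) (*-congˡ (eval-neg φ x)) ⟩
    - fromℤ K a + x * - eval K φ x               ≈⟨ solve 3 (λ a x f → :- a :+ x :* :- f := :- (a :+ x :* f)) refl _ x _ ⟩
    - (fromℤ K a + x * eval K φ x)               ∎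

  eval-⊖ : ∀ φ ψ x → eval K (φ ⊖ ψ) x ≈ eval K φ x - eval K ψ x
  eval-⊖ []      ψ       x = trans (eval-neg ψ x) (sym (+-identityˡ _))
  eval-⊖ (a ∷ φ) []      x = solve 1 (λ f → f := f :- con 0ℤ) refl _
  eval-⊖ (a ∷ φ) (b ∷ ψ) x = begin
    fromℤ K (a ℤ.- b) + x * eval K (φ ⊖ ψ) x
      ≈⟨ +-cong (trans (IntegerImage.fromℤ-+ K a (ℤ.- b)) (+-congˡ (IntegerImage.fromℤ-neg K b)))
                (*-congˡ (eval-⊖ φ ψ x)) ⟩
    fromℤ K a - fromℤ K b + x * (eval K φ x - eval K ψ x)
      ≈⟨ solve 5 (λ a b x f g → a :- b :+ x :* (f :- g) := a :+ x :* f :- (b :+ x :* g)) refl _ _ x _ _ ⟩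
    fromℤ K a + x * eval K φ x - (fromℤ K b + x * eval K ψ x) ∎

  T-cong : ∀ n {x y} → x ≈ y → T n x ≈ T n y
  T-cong n = eval-cong K (Chebyshev n)

  T-index : ∀ {m n} x → m ≡ n → T m x ≈ T n x
  T-index x ≡.refl = refl

  T₀≈2 : ∀ x → T 0 x ≈ two
  T₀≈2 x = solve 1 (λ x → con (+ 2) :+ x :* con 0ℤ := con (+ 2)) refl x

  T₁≈id : ∀ x → T 1 x ≈ x
  T₁≈id x = solve 1 (λ x → con 0ℤ :+ x :* (con 1ℤ :+ x :* con 0ℤ) := x) refl x

  T-rec : ∀ n x → T (suc (suc n)) x ≈ x * T (suc n) x - T n x
  T-rec n x = trans (eval-⊖ (w· Chebyshev (suc n)) (Chebyshev n) x)
                    (+-congʳ (+-identityˡ _))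

  -- Multiply out z + z⁻¹ powers: (zᵐ + z⁻ᵐ)(zᵇ + z⁻ᵇ) with m = b + d. Naming the larger index
  -- `b + d` avoids subtraction. The induction lowers b by one and by two while d grows by the same
  -- amount, which leaves the first factor unchanged.
  T-* : ∀ b d x → T (b ℕ.+ d) x * T b x ≈ T (b ℕ.+ (b ℕ.+ d)) x + T d x
  T-* zero d x = begin
    T d x * T 0 x      ≈⟨ *-congˡ (T₀≈2 x) ⟩
    T d x * two        ≈⟨ solve 1 (λ a → a :* con (+ 2) := a :+ a) refl _ ⟩
    T d x + T d x      ∎
  T-* (suc zero) d x = begin
    T (suc d) x * T 1 x                       ≈⟨ *-congˡ (T₁≈id x) ⟩
    T (suc d) x * x                           ≈⟨ solve 3 (λ a b x → a :* x := x :* a :- b :+ b) refl _ (T d x) x ⟩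
    x * T (suc d) x - T d x + T d x           ≈⟨ +-congʳ (T-rec d x) ⟨
    T (suc (suc d)) x + T d x                 ∎
  T-* (suc (suc b)) d x = begin
    A * T (suc (suc b)) x                     ≈⟨ *-congˡ (T-rec b x) ⟩
    A * (x * T (suc b) x - T b x)             ≈⟨ solve 4 (λ A x B C → A :* (x :* B :- C) := x :* (A :* B) :- A :* C) refl A x _ _ ⟩
    x * (A * T (suc b) x) - A * T b x         ≈⟨ +-cong (*-congˡ (ih₁ (T-* (suc b) (suc d) x))) (-‿cong (ih₂ (T-* b (suc (suc d)) x))) ⟩
    x * (T (suc m) x + T (suc d) x) - (T m x + T (suc (suc d)) x)
      ≈⟨ +-congˡ (-‿cong (+-congˡ (T-rec d x))) ⟩
    x * (T (suc m) x + T (suc d) x) - (T m x + (x * T (suc d) x - T d x))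
      ≈⟨ solve 5 (λ x M₁ D₁ M D → x :* (M₁ :+ D₁) :- (M :+ (x :* D₁ :- D)) := x :* M₁ :- M :+ D) refl x _ _ _ _ ⟩
    x * T (suc m) x - T m x + T d x           ≈⟨ +-congʳ (T-rec m x) ⟨
    T (suc (suc m)) x + T d x                 ≡⟨ ≡.cong (λ k → T k x + T d x) i₃ ⟩
    T (suc (suc b) ℕ.+ (suc (suc b) ℕ.+ d)) x + T d x  ∎
    where
    m = b ℕ.+ (b ℕ.+ suc (suc d))
    A = T (suc (suc b) ℕ.+ d) x

    i₁ : suc (suc b) ℕ.+ d ≡ suc b ℕ.+ suc d
    i₁ = ≡.cong suc (≡.sym (ℕ.+-suc b d))
    i₂ : suc (suc b) ℕ.+ d ≡ b ℕ.+ suc (suc d)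
    i₂ = ≡.trans i₁ (≡.sym (ℕ.+-suc b (suc d)))
    i₃ : suc (suc m) ≡ suc (suc b) ℕ.+ (suc (suc b) ℕ.+ d)
    i₃ = ≡.cong (λ k → suc (suc (b ℕ.+ k))) (≡.sym i₂)
    i₄ : suc b ℕ.+ (suc b ℕ.+ suc d) ≡ suc m
    i₄ = ≡.cong (λ k → suc b ℕ.+ k) (≡.sym (ℕ.+-suc b (suc d)))

    ih₁ : T (suc b ℕ.+ suc d) x * T (suc b) x ≈ T (suc b ℕ.+ (suc b ℕ.+ suc d)) x + T (suc d) x →
          A * T (suc b) x ≈ T (suc m) x + T (suc d) x
    ih₁ ih = begin
      A * T (suc b) x                        ≡⟨ ≡.cong (λ k → T k x * T (suc b) x) i₁ ⟩
      T (suc b ℕ.+ suc d) x * T (suc b) x    ≈⟨ ih ⟩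
      T (suc b ℕ.+ (suc b ℕ.+ suc d)) x + T (suc d) x ≡⟨ ≡.cong (λ k → T k x + T (suc d) x) i₄ ⟩
      T (suc m) x + T (suc d) x              ∎
    ih₂ : T (b ℕ.+ suc (suc d)) x * T b x ≈ T m x + T (suc (suc d)) x →
          A * T b x ≈ T m x + T (suc (suc d)) x
    ih₂ = trans (reflexive (≡.cong (λ k → T k x * T b x) i₂))

  T-square : ∀ b x → T b x * T b x ≈ T (b ℕ.+ b) x + two
  T-square b x = begin
    T b x * T b x                     ≡⟨ ≡.cong (λ k → T k x * T b x) (ℕ.+-identityʳ b) ⟨
    T (b ℕ.+ 0) x * T b x             ≈⟨ T-* b 0 x ⟩
    T (b ℕ.+ (b ℕ.+ 0)) x + T 0 x     ≈⟨ +-congˡ (T₀≈2 x) ⟩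
    T (b ℕ.+ (b ℕ.+ 0)) x + two       ≡⟨ ≡.cong (λ k → T (b ℕ.+ k) x + two) (ℕ.+-identityʳ b) ⟩
    T (b ℕ.+ b) x + two               ∎

  -- By `T-*` with b = n and d = m * n, the values at the multiples of n satisfy the Chebyshev
  -- recurrence with `T n x` in place of x.
  T-∘ : ∀ m n x → T (m ℕ.* n) x ≈ T m (T n x)
  T-∘ zero          n x = trans (T₀≈2 x) (sym (T₀≈2 _))
  T-∘ (suc zero)    n x = trans (T-index x (ℕ.+-identityʳ n)) (sym (T₁≈id _))
  T-∘ (suc (suc m)) n x = begin
    T (n ℕ.+ (n ℕ.+ k)) x                     ≈⟨ solve 2 (λ a b → a := a :+ b :- b) refl _ (T k x) ⟩
    T (n ℕ.+ (n ℕ.+ k)) x + T k x - T k x     ≈⟨ +-congʳ (T-* n k x) ⟨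
    T (n ℕ.+ k) x * T n x - T k x             ≈⟨ +-congʳ (*-comm _ _) ⟩
    T n x * T (n ℕ.+ k) x - T k x             ≈⟨ +-cong (*-congˡ (T-∘ (suc m) n x)) (-‿cong (T-∘ m n x)) ⟩
    T n x * T (suc m) (T n x) - T m (T n x)   ≈⟨ T-rec m (T n x) ⟨
    T (suc (suc m)) (T n x)                   ∎
    where k = m ℕ.* n

  -- With x = z + z⁻¹ both sides are (zᵇ⁺ᵈ + z⁻ᵇ⁻ᵈ − zᵇ − z⁻ᵇ)².
  T-difference² : ∀ b d x →
    (T (b ℕ.+ d) x - T b x) * (T (b ℕ.+ d) x - T b x) ≈
    (T d x - two) * (T (b ℕ.+ (b ℕ.+ d)) x - two)
  T-difference² b d x = begin
    (A - B) * (A - B)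
      ≈⟨ solve 2 (λ A B → (A :- B) :* (A :- B) := A :* A :+ B :* B :- con (+ 2) :* (A :* B)) refl A B ⟩
    A * A + B * B - two * (A * B)
      ≈⟨ +-cong (+-cong (T-square (b ℕ.+ d) x) (T-square b x)) (-‿cong (*-congˡ (T-* b d x))) ⟩
    A₂ + two + (B₂ + two) - two * (S + D)
      ≈⟨ solve 4 (λ A₂ B₂ S D → A₂ :+ con (+ 2) :+ (B₂ :+ con (+ 2)) :- con (+ 2) :* (S :+ D) :=
                                A₂ :+ B₂ :+ con (+ 4) :- con (+ 2) :* (S :+ D)) refl A₂ B₂ S D ⟩
    A₂ + B₂ + fromℤ K (+ 4) - two * (S + D)
      ≈⟨ +-congʳ (+-congʳ SD) ⟨
    S * D + fromℤ K (+ 4) - two * (S + D)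
      ≈⟨ solve 2 (λ S D → S :* D :+ con (+ 4) :- con (+ 2) :* (S :+ D) :=
                          (D :- con (+ 2)) :* (S :- con (+ 2))) refl S D ⟩
    (D - two) * (S - two) ∎
    where
    A  = T (b ℕ.+ d) x
    B  = T b x
    S  = T (b ℕ.+ (b ℕ.+ d)) x
    D  = T d x
    A₂ = T ((b ℕ.+ d) ℕ.+ (b ℕ.+ d)) x
    B₂ = T (b ℕ.+ b) x

    i₁ : ∀ b d → b ℕ.+ (b ℕ.+ d) ≡ d ℕ.+ (b ℕ.+ b)
    i₁ = solve-∀
    i₂ : ∀ b d → d ℕ.+ (d ℕ.+ (b ℕ.+ b)) ≡ (b ℕ.+ d) ℕ.+ (b ℕ.+ d)
    i₂ = solve-∀

    SD : S * D ≈ A₂ + B₂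
    SD = begin
      S * D
        ≈⟨ *-congʳ (T-index x (i₁ b d)) ⟩
      T (d ℕ.+ (b ℕ.+ b)) x * D
        ≈⟨ T-* d (b ℕ.+ b) x ⟩
      T (d ℕ.+ (d ℕ.+ (b ℕ.+ b))) x + B₂
        ≈⟨ +-congʳ (T-index x (i₂ b d)) ⟩
      A₂ + B₂ ∎

  -- In terms of z this is the case distinction between equal and inverse powers; here it comes from
  -- the two factors in `T-difference²`.
  T≈⇒ : ∀ b d x → T (b ℕ.+ d) x ≈ T b x → T d x ≈ two ⊎ T (b ℕ.+ (b ℕ.+ d)) x ≈ two
  T≈⇒ b d x eq = Sum.map -≈0⇒≈ -≈0⇒≈ (integral _ _ (begin
    (T d x - two) * (T (b ℕ.+ (b ℕ.+ d)) x - two)             ≈⟨ T-difference² b d x ⟨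
    (T (b ℕ.+ d) x - T b x) * (T (b ℕ.+ d) x - T b x)         ≈⟨ *-congʳ (≈⇒-≈0 eq) ⟩
    0# * (T (b ℕ.+ d) x - T b x)                              ≈⟨ zeroˡ _ ⟩
    0#                                                        ∎))

  T-d≈2⇒ : ∀ b d x → T d x ≈ two → T (b ℕ.+ d) x ≈ T b x
  T-d≈2⇒ b d x eq = -≈0⇒≈ (square≈0 _ (begin
    _                                                 ≈⟨ T-difference² b d x ⟩
    (T d x - two) * (T (b ℕ.+ (b ℕ.+ d)) x - two)     ≈⟨ *-congʳ (≈⇒-≈0 eq) ⟩
    0# * (T (b ℕ.+ (b ℕ.+ d)) x - two)                ≈⟨ zeroˡ _ ⟩
    0#                                                ∎))

  -- For d ≤ 2 this bounds the number of distinct roots of Tₘ − 2 by about m/2.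
  T-2b+d≈2⇒ : ∀ b d x → T (b ℕ.+ (b ℕ.+ d)) x ≈ two → T (b ℕ.+ d) x ≈ T b x
  T-2b+d≈2⇒ b d x eq = -≈0⇒≈ (square≈0 _ (begin
    _                                                 ≈⟨ T-difference² b d x ⟩
    (T d x - two) * (T (b ℕ.+ (b ℕ.+ d)) x - two)     ≈⟨ *-congˡ (≈⇒-≈0 eq) ⟩
    (T d x - two) * 0#                                ≈⟨ zeroʳ _ ⟩
    0#                                                ∎))

  T[2]≈2 : ∀ k → T k two ≈ two
  T[2]≈2 k = begin
    -- Since 2 = T₀(y) for every y, here y = 0, composition turns the index into k * 0.
    T k two            ≈⟨ T-cong k (T₀≈2 0#) ⟨
    T k (T 0 0#)       ≈⟨ T-∘ k 0 0# ⟨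
    T (k ℕ.* 0) 0#     ≡⟨ ≡.cong (λ j → T j 0#) (ℕ.*-zeroʳ k) ⟩
    T 0 0#             ≈⟨ T₀≈2 0# ⟩
    two                ∎

  T≈2-∣ : ∀ {a b} x → a ∣ b → T a x ≈ two → T b x ≈ two
  T≈2-∣ {a} x (divides k ≡.refl) eq = trans (T-∘ k a x) (trans (T-cong k eq) (T[2]≈2 k))

  -- This is the subtraction step of Euclid's algorithm. If `T≈⇒` yields its second alternative, all
  -- three other terms of the product formula equal 2, and 2 · 2 = 2 + T_d(x) leaves T_d(x) = 2.
  T≈2-∸ : ∀ b d x → T b x ≈ two → T (b ℕ.+ d) x ≈ two → T d x ≈ two
  T≈2-∸ b d x eq₁ eq₂ = [ id , other ]′ (T≈⇒ b d x (trans eq₂ (sym eq₁)))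
    where
    S = T (b ℕ.+ (b ℕ.+ d)) x
    other : S ≈ two → T d x ≈ two
    other eq = begin
      T d x                             ≈⟨ solve 2 (λ s d → d := s :+ d :- s) refl S (T d x) ⟩
      S + T d x - S                     ≈⟨ +-congʳ (T-* b d x) ⟨
      T (b ℕ.+ d) x * T b x - S         ≈⟨ +-cong (*-cong eq₂ eq₁) (-‿cong eq) ⟩
      two * two - two                   ≈⟨ solve 0 (con (+ 2) :* con (+ 2) :- con (+ 2) := con (+ 2)) refl ⟩
      two                               ∎

  -- Over ℕ, Bézout presents the gcd as a difference of a multiple of a and a multiple of b, in one
  -- order or the other; multiples and differences are already covered.
  T≈2-gcd : ∀ a b x → T a x ≈ two → T b x ≈ two → T (gcd a b) x ≈ two
  T≈2-gcd a b x eqᵃ eqᵇ with Bézout.identity (gcd-GCD a b)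
  ... | Bézout.+- u v eq = T≈2-∸ (v ℕ.* b) (gcd a b) x (T≈2-∣ x (divides v ≡.refl) eqᵇ)
          (trans (T-index x (≡.trans (ℕ.+-comm (v ℕ.* b) _) eq)) (T≈2-∣ x (divides u ≡.refl) eqᵃ))
  ... | Bézout.-+ u v eq = T≈2-∸ (u ℕ.* a) (gcd a b) x (T≈2-∣ x (divides u ≡.refl) eqᵃ)
          (trans (T-index x (≡.trans (ℕ.+-comm (u ℕ.* a) _) eq)) (T≈2-∣ x (divides v ≡.refl) eqᵇ))

  -- With T₁(x) = x the hypothesis compares the indices s + 1 and 1: the power of z with exponent s
  -- + 1 is z or z⁻¹. Both Frobenius and periodicity are exploited in this form.
  fixed⇒T≈2 : ∀ s x → T (suc s) x ≈ x → T s x ≈ two ⊎ T (suc (suc s)) x ≈ two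
  fixed⇒T≈2 s x eq = T≈⇒ 1 s x (trans eq (sym (T₁≈id x)))

  T≈2⇒fixed : ∀ s x → T s x ≈ two ⊎ T (suc (suc s)) x ≈ two → T (suc s) x ≈ x
  T≈2⇒fixed s x e = trans ([ T-d≈2⇒ 1 s x , T-2b+d≈2⇒ 1 s x ]′ e) (T₁≈id x)

  -- f is a polynomial function, in Horner form, with a as its possibly zero coefficient of xᵈ.
  HasDegree : ℕ → Carrier → (Carrier → Carrier) → Set (c ⊔ ℓ)
  HasDegree zero    a f = ∀ x → f x ≈ a
  HasDegree (suc d) a f = ∃[ b ] ∃[ g ] HasDegree d a g × (∀ x → f x ≈ b + x * g x)

  degree-cong : ∀ d {a b f g} → a ≈ b → (∀ x → f x ≈ g x) → HasDegree d a f → HasDegree d b g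
  degree-cong zero    a≈b f≈g deg = λ x → trans (sym (f≈g x)) (trans (deg x) a≈b)
  degree-cong (suc d) a≈b f≈g (c , h , deg , eq) =
    c , h , degree-cong d a≈b (λ _ → refl) deg , λ x → trans (sym (f≈g x)) (eq x)

  degree-suc : ∀ d {a f} → HasDegree d a f → HasDegree (suc d) 0# f
  degree-suc zero    {a} deg = a , (λ _ → 0#) , (λ _ → refl) , λ x →
    trans (deg x) (solve 2 (λ a x → a := a :+ x :* con 0ℤ) refl a x)
  degree-suc (suc d) (b , g , deg , eq) = b , g , degree-suc d deg , eq

  degree-raise : ∀ j d {a f} → HasDegree d a f → HasDegree (suc j ℕ.+ d) 0# f
  degree-raise zero    d deg = degree-suc d deg
  degree-raise (suc j) d deg = degree-suc (suc j ℕ.+ d) (degree-raise j d deg)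

  degree-const : ∀ d b → HasDegree (suc d) 0# (λ _ → b)
  degree-const zero    b = degree-suc zero (λ _ → refl)
  degree-const (suc d) b = degree-suc (suc d) (degree-const d b)

  degree-shift : ∀ d {a f} → HasDegree d a f → HasDegree (suc d) a (λ x → x * f x)
  degree-shift d {f = f} deg = 0# , f , deg , λ x → sym (+-identityˡ _)

  degree-+* : ∀ d s {a b f g} → HasDegree d a f → HasDegree d b g →
              HasDegree d (a + s * b) (λ x → f x + s * g x)
  degree-+* zero    s deg₁ deg₂ = λ x → +-cong (deg₁ x) (*-congˡ (deg₂ x))
  degree-+* (suc d) s (c₁ , h₁ , deg₁ , eq₁) (c₂ , h₂ , deg₂ , eq₂) =
    c₁ + s * c₂ , (λ x → h₁ x + s * h₂ x) , degree-+* d s deg₁ deg₂ , λ x →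
    trans (+-cong (eq₁ x) (*-congˡ (eq₂ x)))
      (solve 6 (λ c₁ c₂ x s h₁ h₂ → c₁ :+ x :* h₁ :+ s :* (c₂ :+ x :* h₂) :=
                                    c₁ :+ s :* c₂ :+ x :* (h₁ :+ s :* h₂)) refl c₁ c₂ x s (h₁ x) (h₂ x))

  degree-- : ∀ d {a f g} → HasDegree d a f → HasDegree d 0# g → HasDegree d a (λ x → f x - g x)
  degree-- d {a} {f} {g} deg₁ deg₂ = degree-cong d
    (solve 1 (λ a → a :+ :- con 1ℤ :* con 0ℤ := a) refl a)
    (λ x → solve 2 (λ f g → f :+ :- con 1ℤ :* g := f :- g) refl (f x) (g x))
    (degree-+* d (- fromℤ K 1ℤ) deg₁ deg₂)

  -- For f = b + x h the difference is (x - r) h(x) + r (h(x) - h(r)), and induction divides the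
  -- second term. The quotient keeps the top coefficient `a`, so it remains nonzero while
  -- `#roots≤degree` strips off roots.
  divide : ∀ d {a f} → HasDegree (suc d) a f → ∀ r →
           ∃[ g ] HasDegree d a g × (∀ x → f x - f r ≈ (x - r) * g x)
  divide zero {a} (b , h , deg , eq) r = h , deg , λ x →
    trans (+-cong (eq x) (-‿cong (trans (eq r) (+-congˡ (*-congˡ (trans (deg r) (sym (deg x))))))))
      (solve 4 (λ b h x r → b :+ x :* h :- (b :+ r :* h) := (x :- r) :* h) refl b (h x) x r)
  divide (suc d) {a} {f} (b , h , deg , eq) r with divide d deg r
  ... | h′ , deg′ , eq′ = (λ x → h x + r * h′ x) ,
      degree-cong (suc d) (solve 2 (λ a r → a :+ r :* con 0ℤ := a) refl a r) (λ _ → refl)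
        (degree-+* (suc d) r deg (degree-suc d deg′)) , λ x → begin
      f x - f r                                  ≈⟨ +-cong (eq x) (-‿cong (eq r)) ⟩
      b + x * h x - (b + r * h r)
        ≈⟨ solve 5 (λ b x r hx hr → b :+ x :* hx :- (b :+ r :* hr) :=
                                    (x :- r) :* hx :+ r :* (hx :- hr)) refl b x r (h x) (h r) ⟩
      (x - r) * h x + r * (h x - h r)            ≈⟨ +-congˡ (*-congˡ (eq′ x)) ⟩
      (x - r) * h x + r * ((x - r) * h′ x)
        ≈⟨ solve 4 (λ x r h h′ → (x :- r) :* h :+ r :* ((x :- r) :* h′) :=
                                 (x :- r) :* (h :+ r :* h′)) refl x r (h x) (h′ x) ⟩
      (x - r) * (h x + r * h′ x)                 ∎

  open UniqueSetoid setoid using (Unique)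

  #roots≤degree : ∀ d {a f} → HasDegree d a f → ¬ a ≈ 0# →
                  ∀ xs → Unique xs → All (λ x → f x ≈ 0#) xs → length xs ℕ.≤ d
  #roots≤degree d       deg a≉0 []       _        _                   = z≤n
  #roots≤degree zero    deg a≉0 (x ∷ xs) _        (fx≈0 ∷ _)          = contradiction (trans (sym (deg x)) fx≈0) a≉0
  #roots≤degree (suc d) {f = f} deg a≉0 (r ∷ xs) (r≉ ∷ uniq) (fr≈0 ∷ fxs≈0)
    with g , deg′ , eq ← divide d deg r
    = s≤s (#roots≤degree d deg′ a≉0 xs uniq (All.map root (All.zip (r≉ , fxs≈0))))
    where
    root : ∀ {x} → (¬ r ≈ x) × f x ≈ 0# → g x ≈ 0#
    root {x} (r≉x , fx≈0) = [ (λ e → contradiction (sym (-≈0⇒≈ e)) r≉x) , id ]′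
      (integral (x - r) (g x) (trans (sym (eq x)) (≈⇒-≈0 (trans fx≈0 (sym fr≈0)))))

  -- T₀ is the constant 2, which vanishes in characteristic 2; every later Tₙ is monic.
  leading : ℕ → Carrier
  leading zero    = two
  leading (suc _) = 1#

  T-degree : ∀ n → HasDegree n (leading n) (T n)
  T-degree zero          = T₀≈2
  T-degree (suc zero)    = degree-cong 1 refl
    (λ x → trans (*-identityʳ x) (sym (T₁≈id x))) (degree-shift 0 (λ _ → refl))
  T-degree (suc (suc n)) = degree-cong (suc (suc n)) refl
    (λ x → sym (T-rec n x))
    (degree-- (suc (suc n)) (degree-shift (suc n) (T-degree (suc n)))
                            (degree-suc (suc n) (degree-suc n (T-degree n))))

  #T≈const≤ : ∀ n → 0 ℕ.< n → ∀ y xs → Unique xs → All (λ x → T n x ≈ y) xs → length xs ℕ.≤ n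
  #T≈const≤ (suc n) _ y xs uniq eqs = #roots≤degree (suc n)
    (degree-- (suc n) (T-degree (suc n)) (degree-const n y)) (Field.1≉0 K) xs uniq (All.map ≈⇒-≈0 eqs)

  #T≈2≤ : ∀ n → 0 ℕ.< n → ∀ xs → Unique xs → All (λ x → T n x ≈ two) xs → 2 ℕ.* length xs ℕ.≤ 2 ℕ.+ n
  #T≈2≤ (suc n) _ xs uniq eqs with k , j , j≤1 , 1+n≡ ← halve n =
    halve-bound j≤1 1+n≡ (#roots≤degree (suc j ℕ.+ k) degree (Field.1≉0 K) xs uniq (All.map root eqs))
    where
    -- The gap d = `suc j` is 1 or 2. It is at least 1 so that the difference is monic of degree k +
    -- d, and at most 2 so that this degree is at most half the index plus 1.
    degree : HasDegree (suc j ℕ.+ k) 1# (λ x → T (suc j ℕ.+ k) x - T k x)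
    degree = degree-- (suc j ℕ.+ k) (T-degree (suc j ℕ.+ k)) (degree-raise j k (T-degree k))

    root : ∀ {x} → T (suc n) x ≈ two → T (suc j ℕ.+ k) x - T k x ≈ 0#
    root {x} eq = ≈⇒-≈0 (trans (T-index x (ℕ.+-comm (suc j) k))
      (T-2b+d≈2⇒ k (suc j) x (trans (T-index x (≡.sym 1+n≡)) eq)))

-- Binomial coefficients, Frobenius and the quadratic extension

prime∣!⇒≤ : ∀ {p} → Prime p → ∀ m → p ∣ m ! → p ℕ.≤ m
prime∣!⇒≤ {p} p-prime zero    p∣1 = contradiction (∣1⇒≡1 p∣1) (ℕ.nonTrivial⇒≢1 {{prime⇒nonTrivial p-prime}})
prime∣!⇒≤ {p} p-prime (suc m) p∣m! with euclidsLemma (suc m) (m !) p-prime p∣m!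
... | inj₁ p∣m   = ∣⇒≤ p∣m
... | inj₂ p∣m-1 = ℕ.≤-trans (prime∣!⇒≤ p-prime m p∣m-1) (ℕ.n≤1+n m)

prime∣binomial : ∀ {p} → Prime p → ∀ {k} → 0 ℕ.< k → k ℕ.< p → p ∣ p choose k
prime∣binomial {p} p-prime {k} 0<k k<p = [ id , (λ p∣ → contradiction p∣ ∤) ]′
  (euclidsLemma (p choose k) _ p-prime (∣-trans (p∣p! p p-prime) (∣-reflexive (≡.sym pCk*≡))))
  where
  instance _ = ℕ.m*n≢0 (k !) ((p ℕ.∸ k) !) {{k ℕ.!≢0}} {{(p ℕ.∸ k) ℕ.!≢0}}
  pCk*≡ : (p choose k) ℕ.* (k ! ℕ.* (p ℕ.∸ k) !) ≡ p !
  pCk*≡ = ≡.trans (≡.cong (ℕ._* (k ! ℕ.* (p ℕ.∸ k) !)) (nCk≡n!/k![n-k]! (ℕ.<⇒≤ k<p))) (m/n*n≡m (k![n∸k]!∣n! (ℕ.<⇒≤ k<p)))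
  p∣p! : ∀ p → Prime p → p ∣ p !
  p∣p! zero    pr = contradiction pr ¬prime[0]
  p∣p! (suc p) _  = m∣m*n (p !)
  ∤ : ¬ p ∣ k ! ℕ.* (p ℕ.∸ k) !
  ∤ p∣ with euclidsLemma (k !) _ p-prime p∣
  ... | inj₁ p∣k! = ℕ.<⇒≱ k<p (prime∣!⇒≤ p-prime k p∣k!)
  ... | inj₂ p∣[p-k]! = ℕ.<⇒≱ (ℕ.∸-monoʳ-< 0<k (ℕ.<⇒≤ k<p)) (prime∣!⇒≤ p-prime (p ℕ.∸ k) p∣[p-k]!)

-- Semirings suffice for the binomial theorem, and they spare the extension by z a construction of
-- negatives.
module Frobenius {c ℓ} (S : CommutativeSemiring c ℓ) where

  open CommutativeSemiring S hiding (zero)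
  open import Algebra.Properties.Semiring.Exp semiring using (_^_; ^-congˡ; ^-assocʳ)
  open import Algebra.Properties.Semiring.Mult semiring using (×-assocˡ) renaming (_×_ to _·_)
  open import Algebra.Properties.CommutativeMonoid.Sum +-commutativeMonoid
  open import Algebra.Properties.CommutativeSemiring.Binomial S using (binomialTerm; theorem)
  open import Relation.Binary.Reasoning.Setoid setoid

  module _ {p} (p-prime : Prime p) (p×≈0 : ∀ x → p · x ≈ 0#) where

    ^p-+ : ∀ x y → (x + y) ^ p ≈ x ^ p + y ^ p
    ^p-+ x y = go p ≡.refl
      where
      ∣⇒×≈0 : ∀ {k} → p ∣ k → ∀ z → k · z ≈ 0#
      ∣⇒×≈0 (divides q ≡.refl) z = begin
        (q ℕ.* p) · z   ≡⟨ ≡.cong (_· z) (ℕ.*-comm q p) ⟩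
        (p ℕ.* q) · z   ≈⟨ ×-assocˡ z p q ⟨
        p · (q · z)     ≈⟨ p×≈0 _ ⟩
        0#              ∎

      go : ∀ p′ → p ≡ p′ → (x + y) ^ p′ ≈ x ^ p′ + y ^ p′
      go zero     p≡0    = contradiction (≡.subst Prime p≡0 p-prime) ¬prime[0]
      go (suc p′) ≡.refl = begin
        (x + y) ^ p                                  ≈⟨ theorem p x y ⟩
        sum term                                     ≡⟨⟩
        term Fin.zero + sum (tail term)              ≈⟨ +-congˡ (sum-init-last (tail term)) ⟩
        term Fin.zero + (sum (init (tail term)) + last (tail term))
          ≈⟨ +-cong first (+-cong middle final) ⟩
        y ^ p + (0# + x ^ p)                         ≈⟨ +-congˡ (+-identityˡ _) ⟩
        y ^ p + x ^ p                                ≈⟨ +-comm _ _ ⟩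
        x ^ p + y ^ p                                ∎
        where
        term = binomialTerm x y p
        first : term Fin.zero ≈ y ^ p
        first = trans (+-identityʳ _) (*-identityˡ _)
        -- The inner terms have indices strictly between 0 and p, where p divides the binomial
        -- coefficient.
        middle : sum (init (tail term)) ≈ 0#
        middle = trans (sum-cong-≋ (λ i → ∣⇒×≈0 (prime∣binomial p-prime (s≤s z≤n)
          (s≤s (ℕ.≤-trans (ℕ.≤-reflexive (≡.cong suc (Fin.toℕ-inject₁ i))) (Fin.toℕ<n i)))) _))
          (sum-replicate-zero p′)
        final : last (tail term) ≈ x ^ p
        final = begin
          (p choose suc (toℕ (Fin.fromℕ p′))) · (x ^ suc (toℕ (Fin.fromℕ p′)) * y ^ (p′ ℕ.∸ toℕ (Fin.fromℕ p′)))
            ≡⟨ ≡.cong (λ k → (p choose suc k) · (x ^ suc k * y ^ (p′ ℕ.∸ k))) (Fin.toℕ-fromℕ p′) ⟩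
          (p choose p) · (x ^ p * y ^ (p′ ℕ.∸ p′))
            ≡⟨ ≡.cong₂ (λ k j → k · (x ^ p * y ^ j)) (nCn≡1 p) (ℕ.n∸n≡0 p′) ⟩
          1 · (x ^ p * 1#)  ≈⟨ +-identityʳ _ ⟩
          x ^ p * 1#        ≈⟨ *-identityʳ _ ⟩
          x ^ p             ∎

    ^pⁿ-+ : ∀ n x y → (x + y) ^ (p ℕ.^ n) ≈ x ^ (p ℕ.^ n) + y ^ (p ℕ.^ n)
    ^pⁿ-+ zero    x y = trans (*-identityʳ _) (+-cong (sym (*-identityʳ _)) (sym (*-identityʳ _)))
    ^pⁿ-+ (suc n) x y = begin
      (x + y) ^ (p ℕ.* p ℕ.^ n)                     ≈⟨ ^-assocʳ _ p _ ⟨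
      ((x + y) ^ p) ^ (p ℕ.^ n)                     ≈⟨ ^-congˡ (p ℕ.^ n) (^p-+ x y) ⟩
      (x ^ p + y ^ p) ^ (p ℕ.^ n)                   ≈⟨ ^pⁿ-+ n _ _ ⟩
      (x ^ p) ^ (p ℕ.^ n) + (y ^ p) ^ (p ℕ.^ n)     ≈⟨ +-cong (^-assocʳ _ p _) (^-assocʳ _ p _) ⟩
      x ^ (p ℕ.* p ℕ.^ n) + y ^ (p ℕ.* p ℕ.^ n)     ∎

-- K[z]/(z² − αz + 1) with basis 1, z; there z is a unit and z + z⁻¹ = α.
module QuadraticExtension {c ℓ} (K : Field c ℓ) (_≟_ : Binary.Decidable (Field._≈_ K)) (α : Field.Carrier K) where

  open Field K hiding (zero)
  open IntegerImage K using (module Solver)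
  open Solver
  open DecidableField K _≟_
  open import Algebra.Properties.Semiring.Exp semiring using (_^_)
  open import Algebra.Properties.Semiring.Mult semiring using () renaming (_×_ to _·_)

  extension : CommutativeSemiring c ℓ
  extension = record
    { _+_ = +²._+_
    ; _*_ = mul
    ; 0#  = 0# , 0#
    ; 1#  = 1# , 0#
    ; isCommutativeSemiring = IsCommutativeSemiringˡ.isCommutativeSemiring record
      { +-isCommutativeMonoid = +².isCommutativeMonoid
      ; *-isCommutativeMonoid = record
        { isMonoid = record
          { isSemigroup = record
            { isMagma = record
              { isEquivalence = +².isEquivalence
              ; ∙-cong = λ (a , b) (c , d) →
                  +-cong (*-cong a c) (-‿cong (*-cong b d)) ,
                  +-cong (+-cong (*-cong a d) (*-cong b c)) (*-congˡ (*-cong b d)) }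
            ; assoc = λ (a , b) (c , d) (e , f) →
                solve 7 (λ α a b c d e f →
                  (a :* c :- b :* d) :* e :- (a :* d :+ b :* c :+ α :* (b :* d)) :* f :=
                  a :* (c :* e :- d :* f) :- b :* (c :* f :+ d :* e :+ α :* (d :* f))) refl α a b c d e f ,
                solve 7 (λ α a b c d e f →
                  (a :* c :- b :* d) :* f :+ (a :* d :+ b :* c :+ α :* (b :* d)) :* e
                    :+ α :* ((a :* d :+ b :* c :+ α :* (b :* d)) :* f) :=
                  a :* (c :* f :+ d :* e :+ α :* (d :* f)) :+ b :* (c :* e :- d :* f)
                    :+ α :* (b :* (c :* f :+ d :* e :+ α :* (d :* f)))) refl α a b c d e f }
          ; identity = (λ x → +².trans (mul-comm _ x) (mul-identityʳ x)) , mul-identityʳ }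
        ; comm = mul-comm }
      ; distribʳ = λ (a , b) (c , d) (e , f) →
          solve 7 (λ α a b c d e f → (c :+ e) :* a :- (d :+ f) :* b :=
            c :* a :- d :* b :+ (e :* a :- f :* b)) refl α a b c d e f ,
          solve 7 (λ α a b c d e f → (c :+ e) :* b :+ (d :+ f) :* a :+ α :* ((d :+ f) :* b) :=
            c :* b :+ d :* a :+ α :* (d :* b) :+ (e :* b :+ f :* a :+ α :* (f :* b))) refl α a b c d e f
      ; zeroˡ = λ (a , b) →
          solve 2 (λ a b → con 0ℤ :* a :- con 0ℤ :* b := con 0ℤ) refl a b ,
          solve 3 (λ α a b → con 0ℤ :* b :+ con 0ℤ :* a :+ α :* (con 0ℤ :* b) := con 0ℤ) refl α a b
      }
    }
    where
    module +² where
      open CommutativeMonoid (DirectProduct.commutativeMonoid +-commutativeMonoid +-commutativeMonoid)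
        public renaming (_∙_ to _+_)

    -- The product of a + bz and c + dz, with z² replaced by αz - 1.
    mul : Carrier × Carrier → Carrier × Carrier → Carrier × Carrier
    mul (a , b) (c , d) = a * c - b * d , a * d + b * c + α * (b * d)

    mul-comm : ∀ x y → mul x y +².≈ mul y x
    mul-comm (a , b) (c , d) =
      solve 4 (λ a b c d → a :* c :- b :* d := c :* a :- d :* b) refl a b c d ,
      solve 5 (λ α a b c d → a :* d :+ b :* c :+ α :* (b :* d) := c :* b :+ d :* a :+ α :* (d :* b)) refl α a b c d

    mul-identityʳ : ∀ x → mul x (1# , 0#) +².≈ x
    mul-identityʳ (a , b) =
      trans (+-cong (*-identityʳ a) (-‿cong (zeroʳ b))) (solve 1 (λ a → a :- con 0ℤ := a) refl a) ,
      trans (+-cong (+-cong (zeroʳ a) (*-identityʳ b)) (*-congˡ (zeroʳ b)))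
        (solve 2 (λ α b → con 0ℤ :+ b :+ α :* con 0ℤ := b) refl α b)

  private
    module R = CommutativeSemiring extension
    module Exp = Algebra.Properties.Semiring.Exp R.semiring
    open Algebra.Properties.Semiring.Mult R.semiring using () renaming (_×_ to _·ᴿ_)

  -- The inverse is α - z, because z (α - z) = αz - z² = 1.
  z z⁻¹ : R.Carrier
  z   = 0# , 1#
  z⁻¹ = α , - 1#

  ι : Carrier → R.Carrier
  ι x = x , 0#

  ι-* : ∀ x a b → ι x R.* (a , b) R.≈ (x * a , x * b)
  ι-* x a b = solve 3 (λ x a b → x :* a :- con 0ℤ :* b := x :* a) refl x a b ,
              solve 4 (λ x a b α → x :* b :+ con 0ℤ :* a :+ α :* (con 0ℤ :* b) := x :* b) refl x a b α

  ι-^ : ∀ x n → ι x Exp.^ n R.≈ ι (x ^ n)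
  ι-^ x zero    = R.refl
  ι-^ x (suc n) = R.trans (R.*-congˡ (ι-^ x n)) (R.trans (ι-* x _ 0#) (refl , zeroʳ x))

  n×-componentwise : ∀ n a b → n ·ᴿ (a , b) R.≈ (n · a , n · b)
  n×-componentwise zero    a b = R.refl
  n×-componentwise (suc n) a b = R.+-congˡ (n×-componentwise n a b)

  z+z⁻¹ : z R.+ z⁻¹ R.≈ ι α
  z+z⁻¹ = +-identityˡ α , -‿inverseʳ 1#

  z*z⁻¹ : z R.* z⁻¹ R.≈ R.1#
  z*z⁻¹ = trans (+-cong (zeroˡ α) (-‿cong (*-identityˡ _))) (trans (+-identityˡ _) (-‿involutive 1#)) ,
          trans (+-cong (+-cong (zeroˡ _) (*-identityˡ α)) (*-congˡ (*-identityˡ _)))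
            (trans (+-congˡ (trans (sym (-‿distribʳ-* α 1#)) (-‿cong (*-identityʳ α))))
              (solve 1 (λ a → con 0ℤ :+ a :- a := con 0ℤ) refl α))
    where open import Algebra.Properties.Ring ring using (-‿involutive; -‿distribʳ-*)

  z^n+z^-n : ∀ n → z Exp.^ n R.+ z⁻¹ Exp.^ n R.≈ ι (T n α)
  z^n+z^-n zero = trans (solve 1 (λ a → a :+ a := a :* con (+ 2)) refl 1#) (trans (*-identityˡ two) (sym (T₀≈2 α))) ,
                  +-identityˡ 0#
  z^n+z^-n (suc zero) = R.trans (R.+-cong (R.*-identityʳ z) (R.*-identityʳ z⁻¹))
    (R.trans z+z⁻¹ (sym (T₁≈id α) , refl))
  z^n+z^-n (suc (suc n)) =
      trans (cancel (proj₁ (sum₊ (z^n+z^-n n) (z^n+z^-n (suc n)))))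
        (trans (+-congʳ (solve 2 (λ α t → α :* t :- con 0ℤ :* con 0ℤ := α :* t) refl α _)) (sym (T-rec n α))) ,
      trans (cancel (proj₂ (sum₊ (z^n+z^-n n) (z^n+z^-n (suc n)))))
        (solve 2 (λ α t → α :* con 0ℤ :+ con 0ℤ :* t :+ α :* (con 0ℤ :* con 0ℤ) :- con 0ℤ := con 0ℤ) refl α _)
    where
    module N = Algebra.Solver.Ring.NaturalCoefficients.Default extension
    open import Relation.Binary.Reasoning.Setoid R.setoid
    a = z Exp.^ n
    b = z⁻¹ Exp.^ n
    -- The recurrence is stated additively because the extension is only a semiring. The factor 1 in
    -- front of a + b is rewritten as z z⁻¹, and `cancel` subtracts afterwards in each component.
    sum₊ : a R.+ b R.≈ ι (T n α) → z R.* a R.+ z⁻¹ R.* b R.≈ ι (T (suc n) α) →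
      (z R.* (z R.* a) R.+ z⁻¹ R.* (z⁻¹ R.* b)) R.+ ι (T n α) R.≈ ι α R.* ι (T (suc n) α)
    sum₊ ih₀ ih₁ = begin
      (z R.* (z R.* a) R.+ z⁻¹ R.* (z⁻¹ R.* b)) R.+ ι (T n α)
        ≈⟨ R.+-congˡ ih₀ ⟨
      (z R.* (z R.* a) R.+ z⁻¹ R.* (z⁻¹ R.* b)) R.+ (a R.+ b)
        ≈⟨ R.+-congˡ (R.*-identityˡ _) ⟨
      (z R.* (z R.* a) R.+ z⁻¹ R.* (z⁻¹ R.* b)) R.+ R.1# R.* (a R.+ b)
        ≈⟨ R.+-congˡ (R.*-congʳ z*z⁻¹) ⟨
      (z R.* (z R.* a) R.+ z⁻¹ R.* (z⁻¹ R.* b)) R.+ (z R.* z⁻¹) R.* (a R.+ b)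
        ≈⟨ N.solve 4 (λ z w a b → (z N.:* (z N.:* a) N.:+ w N.:* (w N.:* b)) N.:+ (z N.:* w) N.:* (a N.:+ b) N.:=
                         (z N.:+ w) N.:* (z N.:* a N.:+ w N.:* b)) R.refl z z⁻¹ a b ⟩
      (z R.+ z⁻¹) R.* (z R.* a R.+ z⁻¹ R.* b)
        ≈⟨ R.*-cong z+z⁻¹ ih₁ ⟩
      ι α R.* ι (T (suc n) α) ∎
    cancel : ∀ {u v w} → u + v ≈ w → u ≈ w - v
    cancel {u} {v} eq = trans (solve 2 (λ u v → u := u :+ v :- v) refl u v) (+-congʳ eq)

-- Sums and products over a finite field, and T with index pⁿ

module FiniteFieldProperties {c ℓ N} (F : FiniteField c ℓ N) where

  open FiniteField F
  open Field baseField hiding (zero)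
  open Inverse enumeration using (to; from; to-cong; strictlyInverseˡ; strictlyInverseʳ)
  open import Algebra.Properties.Semiring.Exp semiring using (_^_)
  open import Algebra.Properties.Semiring.Mult semiring using () renaming (_×_ to _·_)
  open import Relation.Binary.Reasoning.Setoid setoid
  open DecidableField baseField (_≈?_ F)
  private
    module Σ = Algebra.Properties.CommutativeMonoid.Sum +-commutativeMonoid
    module Π = Algebra.Properties.CommutativeMonoid.Sum *-commutativeMonoid

  bijection⇒permutation : ∀ (f g : Carrier → Carrier) → (∀ {x y} → x ≈ y → f x ≈ f y) → (∀ {x y} → x ≈ y → g x ≈ g y) →
    (∀ x → f (g x) ≈ x) → (∀ x → g (f x) ≈ x) → Permutation N N
  bijection⇒permutation f g f-cong g-cong fg gf = permutation (λ i → to (f (from i))) (λ i → to (g (from i)))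
    (λ i → ≡.trans (to-cong (trans (f-cong (strictlyInverseʳ _)) (fg (from i)))) (strictlyInverseˡ i))
    (λ i → ≡.trans (to-cong (trans (g-cong (strictlyInverseʳ _)) (gf (from i)))) (strictlyInverseˡ i))

  -- Translation by `a` permutes the field, so the sum of all elements does not change when N · a is
  -- added to it.
  N·≈0 : ∀ a → N · a ≈ 0#
  N·≈0 a = begin
    N · a                              ≈⟨ solve 2 (λ s n → n := s :+ n :- s) refl S (N · a) ⟩
    S + N · a - S                      ≈⟨ +-congʳ shifted ⟨
    S - S                              ≈⟨ -‿inverseʳ S ⟩
    0#                                 ∎
    where
    open IntegerImage.Solver baseField
    S = Σ.sum from
    π = bijection⇒permutation (_+ a) (_- a) +-congʳ +-congʳ
          (λ x → solve 2 (λ x a → x :- a :+ a := x) refl x a)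
          (λ x → solve 2 (λ x a → x :+ a :- a := x) refl x a)
    shifted : S ≈ S + N · a
    shifted = begin
      S                                  ≈⟨ Σ.sum-permute from π ⟩
      Σ.sum (λ i → from (π ⟨$⟩ʳ i))      ≈⟨ Σ.sum-cong-≋ {N} (λ i → strictlyInverseʳ (from i + a)) ⟩
      Σ.sum (λ i → from i + a)           ≈⟨ Σ.∑-distrib-+ from (λ _ → a) ⟩
      S + Σ.sum {N} (λ _ → a)            ≈⟨ +-congˡ (Σ.sum-replicate N) ⟩
      S + N · a                          ∎

  ∏≉0 : ∀ {n} (v : Vector Carrier n) → (∀ i → ¬ v i ≈ 0#) → ¬ Π.sum v ≈ 0#
  ∏≉0 {zero}  v v≉0 = Field.1≉0 baseField
  ∏≉0 {suc n} v v≉0 eq = [ v≉0 Fin.zero , ∏≉0 (tail v) (λ i → v≉0 (Fin.suc i)) ]′ (integral _ _ eq)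

  private
    unlessZero : ∀ {y} → Dec (y ≈ 0#) → Carrier → Carrier
    unlessZero (yes _) x = 1#
    unlessZero (no  _) x = x

  -- Multiplication by x permutes the nonzero elements, whose product is therefore multiplied by
  -- x^(N−1) and unchanged.  The products run over all elements, with trivial factor at 0.
  ^N-1≈1 : ∀ {m} → N ≡ suc m → ∀ x → ¬ x ≈ 0# → x ^ m ≈ 1#
  ^N-1≈1 {m} ≡.refl x x≉0 with w , xw≈1 ← inverse x x≉0 = begin
    x ^ m                ≈⟨ Π.sum-replicate m ⟨
    Π.sum {m} (λ _ → x)  ≈⟨ Π.sum-cong-≋ (λ j → h-nonzero (punchIn i₀ j) (Fin.punchInᵢ≢i i₀ j)) ⟨
    Π.sum (removeAt h i₀)        ≈⟨ *-identityˡ _ ⟨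
    1# * Π.sum (removeAt h i₀)   ≈⟨ *-congʳ h-zero ⟨
    h i₀ * Π.sum (removeAt h i₀) ≈⟨ Π.sum-remove {i = i₀} h ⟨
    Π.sum h              ≈⟨ ∏h≈1 ⟩
    1#                   ∎
    where
    wx≈1 : w * x ≈ 1#
    wx≈1 = trans (*-comm w x) xw≈1
    π = bijection⇒permutation (x *_) (w *_) *-congˡ *-congˡ
      (λ y → trans (sym (*-assoc x w y)) (trans (*-congʳ xw≈1) (*-identityˡ y)))
      (λ y → trans (sym (*-assoc w x y)) (trans (*-congʳ wx≈1) (*-identityˡ y)))
    i₀ = to 0#
    g h : Fin N → Carrier
    g i = unlessZero (_≈?_ F (from i) 0#) (from i)
    h i = unlessZero (_≈?_ F (from i) 0#) x

    h-zero : h i₀ ≈ 1#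
    h-zero with _≈?_ F (from i₀) 0#
    ... | yes _ = refl
    ... | no ≉0 = contradiction (strictlyInverseʳ 0#) ≉0
    h-nonzero : ∀ i → ¬ i ≡ i₀ → h i ≈ x
    h-nonzero i i≢ with _≈?_ F (from i) 0#
    ... | yes ≈0 = contradiction (≡.trans (≡.sym (strictlyInverseˡ i)) (to-cong ≈0)) i≢
    ... | no _ = refl
    g≉0 : ∀ i → ¬ g i ≈ 0#
    g≉0 i with _≈?_ F (from i) 0#
    ... | yes _ = Field.1≉0 baseField
    ... | no ≉0 = ≉0
    g∘π : ∀ i → g (π ⟨$⟩ʳ i) ≈ h i * g i
    g∘π i with _≈?_ F (from i) 0# | _≈?_ F (from (π ⟨$⟩ʳ i)) 0#
    ... | yes _  | yes _  = sym (*-identityˡ 1#)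
    ... | yes ≈0 | no ≉0  = contradiction (trans (strictlyInverseʳ _) (trans (*-congˡ ≈0) (zeroʳ x))) ≉0
    ... | no ≉0  | yes ≈0 = contradiction (integral x _ (trans (sym (strictlyInverseʳ _)) ≈0)) [ x≉0 , ≉0 ]′
    ... | no _   | no _   = strictlyInverseʳ _

    ∏h≈1 : Π.sum h ≈ 1#
    ∏h≈1 = *-cancelˡ-nonZero (∏≉0 g g≉0) (begin
      Π.sum g * Π.sum h                 ≈⟨ *-comm _ _ ⟩
      Π.sum h * Π.sum g                 ≈⟨ Π.∑-distrib-+ h g ⟨
      Π.sum (λ i → h i * g i)           ≈⟨ Π.sum-cong-≋ g∘π ⟨
      Π.sum (λ i → g (π ⟨$⟩ʳ i))        ≈⟨ Π.sum-permute g π ⟨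
      Π.sum g                           ≈⟨ *-identityʳ _ ⟨
      Π.sum g * 1#                      ∎)

  N≡suc : ∃[ m ] N ≡ suc m
  N≡suc = go (to 0#) where
    go : ∀ {N} → Fin N → ∃[ m ] N ≡ suc m
    go {suc m} _ = m , ≡.refl

  ^N≈id : ∀ x → x ^ N ≈ x
  ^N≈id x with m , N≡ ← N≡suc with _≈?_ F x 0#
  ... | yes x≈0 = begin
    x ^ N       ≡⟨ ≡.cong (x ^_) N≡ ⟩
    x * x ^ m   ≈⟨ *-congʳ x≈0 ⟩
    0# * x ^ m  ≈⟨ zeroˡ _ ⟩
    0#          ≈⟨ x≈0 ⟨
    x           ∎
  ... | no x≉0 = begin
    x ^ N       ≡⟨ ≡.cong (x ^_) N≡ ⟩
    x * x ^ m   ≈⟨ *-congˡ (^N-1≈1 N≡ x x≉0) ⟩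
    x * 1#      ≈⟨ *-identityʳ x ⟩
    x           ∎

module PrimePowerField {c ℓ p n} (p-prime : Prime p) (F : FiniteField c ℓ (p ℕ.^ n)) where

  open FiniteField F
  open Field baseField hiding (zero)
  open FiniteFieldProperties F
  open DecidableField baseField (_≈?_ F)
  open import Algebra.Properties.Semiring.Exp semiring using (_^_)
  open import Algebra.Properties.Semiring.Mult semiring using (×1-homo-*; ×-assoc-*; ×-congʳ) renaming (_×_ to _·_)

  -- pⁿ · 1 = 0 is a product of n factors p · 1, and a field has no zero divisors.
  p·1≈0 : p · 1# ≈ 0#
  p·1≈0 = go n (N·≈0 1#)
    where
    go : ∀ n → (p ℕ.^ n) · 1# ≈ 0# → p · 1# ≈ 0#
    go zero    1≈0 = contradiction (trans (sym (+-identityʳ 1#)) 1≈0) (Field.1≉0 baseField)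
    go (suc n) eq  = [ id , go n ]′ (integral _ _ (trans (sym (×1-homo-* p (p ℕ.^ n))) eq))

  p·≈0 : ∀ x → p · x ≈ 0#
  p·≈0 x = trans (×-congʳ p (sym (*-identityˡ x)))
    (trans (sym (×-assoc-* p 1# x)) (trans (*-congʳ p·1≈0) (zeroˡ x)))

  -- In the extension z^N + z⁻ᴺ = (z + z⁻¹)^N = x^N = x, by Frobenius and `^N≈id`; first components
  -- give the claim. The computation is the same whether or not z² - xz + 1 splits.
  T[pⁿ]≈id : ∀ x → T (p ℕ.^ n) x ≈ x
  T[pⁿ]≈id x = proj₁ (begin
    ι (T N x)                        ≈⟨ z^n+z^-n N ⟨
    z Exp.^ N R.+ z⁻¹ Exp.^ N        ≈⟨ Frobenius.^pⁿ-+ extension p-prime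
                                          (λ (a , b) → R.trans (n×-componentwise p a b) (p·≈0 a , p·≈0 b)) n z z⁻¹ ⟨
    (z R.+ z⁻¹) Exp.^ N              ≈⟨ Exp.^-congˡ N z+z⁻¹ ⟩
    ι x Exp.^ N                      ≈⟨ ι-^ x N ⟩
    ι (x ^ N)                        ≈⟨ ^N≈id x , refl ⟩
    ι x                              ∎)
    where
    N = p ℕ.^ n
    open QuadraticExtension baseField (_≈?_ F) x
    module R = CommutativeSemiring extension
    module Exp = Algebra.Properties.Semiring.Exp R.semiring
    open import Relation.Binary.Reasoning.Setoid R.setoid

open import Data.Nat.Base using (_+_; _*_; _∸_; _^_; _≤_; _<_)

-- Powers modulo M

*-positive⁻¹ : ∀ m n → 0 < m * n → 0 < m × 0 < n
*-positive⁻¹ (suc m) (suc n) _     = s≤s z≤n , s≤s z≤n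
*-positive⁻¹ (suc m) zero    0<m*0 = contradiction (ℕ.*-zeroʳ m) (ℕ.<⇒≢ 0<m*0 ∘ ≡.sym)

%-+-≡⇒∣ : ∀ u v M .{{_ : NonZero M}} → (u + v) ℕ.% M ≡ u ℕ.% M → M ∣ v
%-+-≡⇒∣ u v M eq = ∣m+n∣m⇒∣n (divides ((u + v) ℕ./ M) (ℕ.+-cancelˡ-≡ (u ℕ.% M) _ _ (begin
  u ℕ.% M + ((u ℕ./ M) * M + v)          ≡⟨ ℕ.+-assoc (u ℕ.% M) _ v ⟨
  u ℕ.% M + (u ℕ./ M) * M + v            ≡⟨ ≡.cong (_+ v) (m≡m%n+[m/n]*n u M) ⟨
  u + v                                  ≡⟨ m≡m%n+[m/n]*n (u + v) M ⟩
  (u + v) ℕ.% M + ((u + v) ℕ./ M) * M    ≡⟨ ≡.cong (_+ ((u + v) ℕ./ M) * M) eq ⟩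
  u ℕ.% M + ((u + v) ℕ./ M) * M          ∎))) (n∣m*n (u ℕ./ M))
  where open ≡.≡-Reasoning

coprime-^ : ∀ {m n} → Coprime m n → ∀ k → Coprime m (n ^ k)
coprime-^ m⊥n zero    (_ , d∣1) = ∣1⇒≡1 d∣1
coprime-^ m⊥n (suc k) {d} (d∣m , d∣n*n^k) = coprime-^ m⊥n k
  (d∣m , coprime-divisor (λ (e∣d , e∣n) → m⊥n (∣-trans e∣d d∣m , e∣n)) d∣n*n^k)

-- Leaving out the value 0 with `punchOut` sharpens the pigeonhole by one. This yields the strict
-- bound m < M in `∃-order`, which `ord<q` relies on.
pigeonhole-positive : ∀ {M} (f : ℕ → ℕ) → (∀ i → f i ≢ 0) → (∀ i → f i < suc M) →
                      ∃[ i ] ∃[ d ] i + suc d < suc M × f i ≡ f (i + suc d)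
pigeonhole-positive {M} f f≢0 f<M = step (Fin.pigeonhole (ℕ.n<1+n M) index)
  where
  value : ℕ → Fin (suc M)
  value i = Fin.fromℕ< (f<M i)

  value≢0 : ∀ i → Fin.zero ≢ value i
  value≢0 i 0≡ = f≢0 i (≡.trans (≡.sym (Fin.toℕ-fromℕ< (f<M i))) (≡.cong toℕ (≡.sym 0≡)))

  index : Fin (suc M) → Fin M
  index i = punchOut (value≢0 (toℕ i))

  step : ∃[ i ] ∃[ j ] i Fin.< j × index i ≡ index j →
         ∃[ i ] ∃[ d ] i + suc d < suc M × f i ≡ f (i + suc d)
  step (i , j , i<j , eq) with d , 1+i+d≡j ← ℕ.m≤n⇒∃[o]m+o≡n i<j =
    toℕ i , d , ≡.subst (_< suc M) (≡.sym i+1+d≡j) (Fin.toℕ<n j) , ≡.trans fi≡fj (≡.cong f (≡.sym i+1+d≡j))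
    where
    i+1+d≡j : toℕ i + suc d ≡ toℕ j
    i+1+d≡j = ≡.trans (ℕ.+-suc (toℕ i) d) 1+i+d≡j

    fi≡fj : f (toℕ i) ≡ f (toℕ j)
    fi≡fj = Fin.fromℕ<-injective _ _ (f<M (toℕ i)) (f<M (toℕ j))
      (Fin.punchOut-injective (value≢0 (toℕ i)) (value≢0 (toℕ j)) eq)

module _ {a M} (1<M : 1 < M) (M⊥a : Coprime M a) where

  private
    instance
      M-nonZero : NonZero M
      M-nonZero = ℕ.>-nonZero (ℕ.<-trans (s≤s z≤n) 1<M)

    M∤a^ : ∀ i → ¬ M ∣ a ^ i
    M∤a^ i M∣ = ℕ.<⇒≢ 1<M (≡.sym (coprime-^ M⊥a i (∣-refl , M∣)))

    -- Equal residues mean that M divides aⁱ (b - 1), where b is the power with exponent d + 1, and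
    -- aⁱ is prime to M. The power is generalised to b so that matching exposes its predecessor.
    power : ∀ i d b → (a ^ i) ℕ.% M ≡ (a ^ (i + suc d)) ℕ.% M → a ^ suc d ≡ b → ∃[ e ] b ≡ suc e × M ∣ e
    power i d zero    eq a^≡ = contradiction (≡.subst (M ∣_) (≡.sym a^≡) (M ∣0)) (M∤a^ (suc d))
    power i d (suc e) eq a^≡ = e , ≡.refl , coprime-divisor (coprime-^ M⊥a i) (%-+-≡⇒∣ (a ^ i) (a ^ i * e) M (begin
      (a ^ i + a ^ i * e) ℕ.% M   ≡⟨ ≡.cong (ℕ._% M) (ℕ.*-suc (a ^ i) e) ⟨
      (a ^ i * suc e) ℕ.% M       ≡⟨ ≡.cong (λ b → (a ^ i * b) ℕ.% M) a^≡ ⟨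
      (a ^ i * a ^ suc d) ℕ.% M   ≡⟨ ≡.cong (ℕ._% M) (ℕ.^-distribˡ-+-* a i (suc d)) ⟨
      (a ^ (i + suc d)) ℕ.% M     ≡⟨ eq ⟨
      (a ^ i) ℕ.% M               ∎))
      where open ≡.≡-Reasoning

    pred+1≡ : suc (ℕ.pred M) ≡ M
    pred+1≡ = ℕ.suc-pred M

    -- The residues of a⁰, …, a^(M−1) all lie among the M − 1 nonzero ones.
    repetition : ∃[ i ] ∃[ d ] i + suc d < suc (ℕ.pred M) × (a ^ i) ℕ.% M ≡ (a ^ (i + suc d)) ℕ.% M
    repetition = pigeonhole-positive (λ i → (a ^ i) ℕ.% M)
      (λ i eq → M∤a^ i (m%n≡0⇒n∣m (a ^ i) M eq))
      (λ i → ≡.subst ((a ^ i) ℕ.% M <_) (≡.sym pred+1≡) (m%n<n (a ^ i) M))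

  ∃-order : ∃[ m ] 0 < m × m < M × ∃[ e ] a ^ m ≡ suc e × M ∣ e
  ∃-order = finish repetition
    where
    finish : ∃[ i ] ∃[ d ] i + suc d < suc (ℕ.pred M) × (a ^ i) ℕ.% M ≡ (a ^ (i + suc d)) ℕ.% M →
             ∃[ m ] 0 < m × m < M × ∃[ e ] a ^ m ≡ suc e × M ∣ e
    finish (i , d , i+d<M , eq) = suc d , s≤s z≤n ,
      ≡.subst (suc d <_) pred+1≡ (ℕ.≤-<-trans (ℕ.m≤n+m (suc d) i) i+d<M) ,
      power i d (a ^ suc d) eq ≡.refl

∃-power≡1 : ∀ {a M} → 0 < M → 0 < a → Coprime M a → ∃[ m ] 0 < m × ∃[ e ] a ^ m ≡ suc e × M ∣ e
∃-power≡1 {suc a} {suc zero}    _ _ _ = 1 , s≤s z≤n , a , ℕ.*-identityʳ (suc a) , 1∣ a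
∃-power≡1 {a} {M@(suc (suc _))} _ _ M⊥a = forget (∃-order (s≤s (s≤s z≤n)) M⊥a)
  where
  -- Not by `with`, which would evaluate the pigeonhole search in ∃-order.
  forget : ∃[ m ] 0 < m × m < M × ∃[ e ] a ^ m ≡ suc e × M ∣ e → ∃[ m ] 0 < m × ∃[ e ] a ^ m ≡ suc e × M ∣ e
  forget (m , 0<m , _ , rest) = m , 0<m , rest

prime∤⇒coprime : ∀ {q n} → Prime q → ¬ q ∣ n → Coprime q n
prime∤⇒coprime q-prime q∤n (d∣q , d∣n) with prime⇒irreducible q-prime d∣q
... | inj₁ d≡1    = d≡1
... | inj₂ ≡.refl = contradiction d∣n q∤n

prime∣prime⇒≡ : ∀ {p q} → Prime p → Prime q → q ∣ p → q ≡ p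
prime∣prime⇒≡ p-prime q-prime q∣p with prime⇒irreducible p-prime q∣p
... | inj₁ ≡.refl = contradiction ≡.refl (ℕ.nonTrivial⇒≢1 {{prime⇒nonTrivial q-prime}})
... | inj₂ q≡p    = q≡p

prime≥2 : ∀ {q} → Prime q → 1 < q
prime≥2 q-prime = ℕ.nonTrivial⇒n>1 _ {{prime⇒nonTrivial q-prime}}

coprime-product : ∀ {m ns} → All (Coprime m) ns → Coprime m (product ns)
coprime-product []                          (_ , d∣1) = ∣1⇒≡1 d∣1
coprime-product {m} {n ∷ ns} (m⊥n ∷ m⊥ns) (d∣m , d∣n*) = coprime-product m⊥ns
  (d∣m , coprime-divisor (λ (e∣d , e∣n) → m⊥n (∣-trans e∣d d∣m , e∣n)) d∣n*)

coprime-∣-* : ∀ {a b x} → Coprime a b → a ∣ x → b ∣ x → a * b ∣ x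
coprime-∣-* {a} {b} a⊥b (divides y ≡.refl) b∣ya = ≡.subst (a * b ∣_) (ℕ.*-comm a y)
  (*-monoʳ-∣ a (coprime-divisor (Coprimality.sym a⊥b) (≡.subst (b ∣_) (ℕ.*-comm y a) b∣ya)))

-- Valuations and lifting the exponent

module _ {q} (q-prime : Prime q) where

  private instance _ = prime⇒nonZero q-prime

  valuation⇒ : ∀ {n} k → IsValuation q n k → ∃[ w ] n ≡ w * q ^ k × ¬ q ∣ w
  valuation⇒ {n} k (divides w n≡ , q^1+k∤n) = w , n≡ , λ q∣w →
    q^1+k∤n (≡.subst (q ^ suc k ∣_) (≡.sym n≡) (*-monoˡ-∣ (q ^ k) q∣w))

  ⇒valuation : ∀ {n} w k → n ≡ w * q ^ k → ¬ q ∣ w → IsValuation q n k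
  ⇒valuation w k ≡.refl q∤w = n∣m*n w , λ q^1+k∣ → q∤w (*-cancelʳ-∣ (q ^ k) {{ℕ.m^n≢0 q k}} q^1+k∣)

  valuation-* : ∀ {m n} j k → IsValuation q m j → IsValuation q n k → IsValuation q (m * n) (j + k)
  valuation-* j k vm vn with valuation⇒ j vm | valuation⇒ k vn
  ... | w , ≡.refl , q∤w | x , ≡.refl , q∤x = ⇒valuation (w * x) (j + k)
    (≡.trans (rearrange w (q ^ j) x (q ^ k)) (≡.cong (w * x *_) (≡.sym (ℕ.^-distribˡ-+-* q j k))))
    (λ q∣wx → [ q∤w , q∤x ]′ (euclidsLemma w x q-prime q∣wx))
    where
    rearrange : ∀ a b c d → a * b * (c * d) ≡ a * c * (b * d)
    rearrange = solve-∀

  ∤⇒valuation-0 : ∀ {n} → ¬ q ∣ n → IsValuation q n 0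
  ∤⇒valuation-0 {n} q∤n = ⇒valuation n 0 (≡.sym (ℕ.*-identityʳ n)) q∤n

  valuation-*ˡ : ∀ {m n} k → ¬ q ∣ m → IsValuation q (m * n) k → IsValuation q n k
  valuation-*ˡ {m} {n} k q∤m (q^k∣ , q^1+k∤) =
    coprime-divisor (Coprimality.sym (coprime-^ (Coprimality.sym (prime∤⇒coprime q-prime q∤m)) k)) q^k∣ ,
    λ q^1+k∣n → q^1+k∤ (∣n⇒∣m*n m q^1+k∣n)

-- With C = 1 + c this is 1 + C + ⋯ with m terms, in Horner form.
geometric : ℕ → ℕ → ℕ
geometric c zero    = 0
geometric c (suc m) = 1 + suc c * geometric c m

^-geometric : ∀ c m → suc c ^ m ≡ suc (c * geometric c m)
^-geometric c zero    = ≡.cong suc (≡.sym (ℕ.*-zeroʳ c))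
^-geometric c (suc m) = ≡.trans (≡.cong (suc c *_) (^-geometric c m)) (expand c (geometric c m))
  where
  expand : ∀ c g → suc c * suc (c * g) ≡ suc (c * (1 + suc c * g))
  expand = solve-∀

-- The binomial coefficient m(m - 1)/2.
triangle : ℕ → ℕ
triangle zero    = 0
triangle (suc m) = triangle m + m

2*triangle : ∀ m → 2 * triangle (suc m) ≡ suc m * m
2*triangle zero    = ≡.refl
2*triangle (suc m) = ≡.trans (ℕ.*-distribˡ-+ 2 (triangle (suc m)) (suc m))
  (≡.trans (≡.cong (_+ 2 * suc m) (2*triangle m)) (expand m))
  where
  expand : ∀ m → suc m * m + 2 * suc m ≡ suc (suc m) * suc m
  expand = solve-∀

-- The quotient ((1 + c)ᵐ − 1)/c modulo c²; it gives the q-adic valuation both for q ∤ m and for m = q.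
geometric-expansion : ∀ c m → ∃[ k ] geometric c m ≡ m + c * triangle m + c * c * k
geometric-expansion c zero    = 0 , ≡.sym (zeros c)
  where
  zeros : ∀ c → 0 + c * 0 + c * c * 0 ≡ 0
  zeros = solve-∀
geometric-expansion c (suc m) with k , eq ← geometric-expansion c m = triangle m + suc c * k ,
  ≡.trans (≡.cong (λ g → 1 + suc c * g) eq) (expand c m (triangle m) k)
  where
  expand : ∀ c m t k → 1 + suc c * (m + c * t + c * c * k) ≡ suc m + c * (t + m) + c * c * (t + suc c * k)
  expand = solve-∀

module LiftingTheExponent {q} (q-prime : Prime q) (2∤q : ¬ 2 ∣ q) where

  private instance _ = prime⇒nonZero q-prime

  q∤2 : ¬ q ∣ 2
  q∤2 q∣2 = 2∤q (∣-reflexive (≡.sym (prime∣prime⇒≡ prime[2] q-prime q∣2)))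

  -- Oddness of q enters here: q divides q(q - 1), and the denominator 2 cannot absorb it.
  q∣triangle : q ∣ triangle q
  q∣triangle = [ (λ q∣2 → contradiction q∣2 q∤2) , id ]′
    (euclidsLemma 2 (triangle q) q-prime (q∣2*triangle q (prime≥2 q-prime)))
    where
    q∣2*triangle : ∀ q → 1 < q → q ∣ 2 * triangle q
    q∣2*triangle (suc q) _ = ≡.subst (suc q ∣_) (≡.sym (2*triangle q)) (m∣m*n q)

  valuation-geometric : ∀ {c m} → q ∣ c → ¬ q ∣ m → IsValuation q (geometric c m) 0
  valuation-geometric {c} {m} q∣c q∤m with k , eq ← geometric-expansion c m =
    ∤⇒valuation-0 q-prime λ q∣g → q∤m (∣m+n∣m⇒∣n
      (≡.subst (q ∣_) (≡.trans eq (rearrange c m (triangle m) k)) q∣g) (∣m⇒∣m*n (triangle m + c * k) q∣c))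
    where
    rearrange : ∀ c m t k → m + c * t + c * c * k ≡ c * (t + c * k) + m
    rearrange = solve-∀

  -- With c = dq and `triangle q` = uq, the expansion becomes q (1 + q (du + d²k)).
  valuation-geometric-q : ∀ {c} → q ∣ c → IsValuation q (geometric c q) 1
  valuation-geometric-q {c} (divides d ≡.refl)
    with k , eq ← geometric-expansion c q | divides u t≡ ← q∣triangle =
    ⇒valuation q-prime (1 + q * (d * u + d * d * k)) 1 (≡.trans eq
      (≡.trans (≡.cong (λ t → q + d * q * t + d * q * (d * q) * k) t≡) (factor d q u k)))
      λ q∣ → q∤1 (∣m+n∣m⇒∣n (≡.subst (q ∣_) (ℕ.+-comm 1 _) q∣) (m∣m*n (d * u + d * d * k)))
    where
    factor : ∀ d q u k → q + d * q * (u * q) + d * q * (d * q) * k ≡ (1 + q * (d * u + d * d * k)) * (q * 1)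
    factor = solve-∀
    q∤1 : ¬ q ∣ 1
    q∤1 q∣1 = contradiction (∣1⇒≡1 q∣1) (ℕ.<⇒≢ (prime≥2 q-prime) ∘ ≡.sym)

  module _ {c} μ (q∣c : q ∣ c) (v : IsValuation q c μ) where

    valuation-^ : ∀ m → ¬ q ∣ m → IsValuation q (suc c ^ m ∸ 1) μ
    valuation-^ m q∤m = ≡.subst₂ (IsValuation q) (≡.cong ℕ.pred (≡.sym (^-geometric c m))) (ℕ.+-identityʳ μ)
      (valuation-* q-prime μ 0 v (valuation-geometric q∣c q∤m))

    valuation-^q : IsValuation q (suc c ^ q ∸ 1) (suc μ)
    valuation-^q = ≡.subst₂ (IsValuation q) (≡.cong ℕ.pred (≡.sym (^-geometric c q))) (ℕ.+-comm μ 1)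
      (valuation-* q-prime μ 1 v (valuation-geometric-q q∣c))

  -- Induction on ν with a changing base: passing from 1 + c to its q-th power raises μ by one and
  -- takes one factor q out of the exponent. At ν = 0 the exponent is prime to q.
  lifting-the-exponent : ∀ {c} μ → q ∣ c → IsValuation q c μ → ∀ ν {m} → IsValuation q m ν →
        IsValuation q (suc c ^ m ∸ 1) (μ + ν)
  lifting-the-exponent {c} μ q∣c vc zero {m} vm = ≡.subst (IsValuation q _) (≡.sym (ℕ.+-identityʳ μ))
    (valuation-^ μ q∣c vc m (λ q∣m → proj₂ vm (≡.subst (_∣ m) (≡.sym (ℕ.*-identityʳ q)) q∣m)))
  lifting-the-exponent {c} μ q∣c vc (suc ν) vm with w , ≡.refl , q∤w ← valuation⇒ q-prime (suc ν) vm =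
    ≡.subst₂ (λ x k → IsValuation q (x ∸ 1) k) power (≡.sym (ℕ.+-suc μ ν))
      (lifting-the-exponent (suc μ) (∣-trans q∣c (≡.subst (c ∣_) (≡.cong ℕ.pred (≡.sym (^-geometric c q))) (m∣m*n (geometric c q))))
           (valuation-^q μ q∣c vc) ν (⇒valuation q-prime w ν ≡.refl q∤w))
    where
    open ≡.≡-Reasoning
    suc-pred≡ : suc (suc c ^ q ∸ 1) ≡ suc c ^ q
    suc-pred≡ = ≡.trans (≡.cong (suc ∘ ℕ.pred) (^-geometric c q)) (≡.sym (^-geometric c q))
    power : suc (suc c ^ q ∸ 1) ^ (w * q ^ ν) ≡ suc c ^ (w * q ^ suc ν)
    power = begin
      suc (suc c ^ q ∸ 1) ^ (w * q ^ ν)  ≡⟨ ≡.cong (_^ (w * q ^ ν)) suc-pred≡ ⟩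
      (suc c ^ q) ^ (w * q ^ ν)          ≡⟨ ℕ.^-*-assoc (suc c) q (w * q ^ ν) ⟩
      suc c ^ (q * (w * q ^ ν))          ≡⟨ ≡.cong (suc c ^_) (rearrange q w (q ^ ν)) ⟩
      suc c ^ (w * q ^ suc ν)            ∎
      where
      rearrange : ∀ q w x → q * (w * x) ≡ w * (q * x)
      rearrange = solve-∀

-- The order of p modulo q and the valuations of pⁿ - 1 and pⁿ + 1

n<p^n : ∀ {p} → 1 < p → ∀ n → n < p ^ n
n<p^n     1<p zero    = s≤s z≤n
n<p^n {p} 1<p (suc n) = begin-strict
  suc n           ≤⟨ n<p^n 1<p n ⟩
  p ^ n           <⟨ ℕ.m<m*n (p ^ n) p {{ℕ.>-nonZero (ℕ.≤-<-trans z≤n (n<p^n 1<p n))}} 1<p ⟩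
  p ^ n * p       ≡⟨ ℕ.*-comm (p ^ n) p ⟩
  p ^ suc n       ∎
  where open ℕ.≤-Reasoning

1+[p^n-1]≡p^n : ∀ {p} → Prime p → ∀ n → suc (p ^ n ∸ 1) ≡ p ^ n
1+[p^n-1]≡p^n {p} p-prime n = ℕ.m+[n∸m]≡n (ℕ.m^n>0 p {{prime⇒nonZero p-prime}} n)

module MultiplicativeOrder {q p k} (q-prime : Prime q) (2∤q : ¬ 2 ∣ q) (p-prime : Prime p) (p≢q : p ≢ q)
                           (isOrd : IsOrd q p k) where

  open LiftingTheExponent q-prime 2∤q

  private
    0<k = proj₁ isOrd
    q∣p^k-1 = proj₁ (proj₂ isOrd)
    minimal = proj₂ (proj₂ isOrd)
    instance
      k-nonZero : NonZero k
      k-nonZero = ℕ.>-nonZero 0<k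

  q∤p : ¬ q ∣ p
  q∤p q∣p = p≢q (≡.sym (prime∣prime⇒≡ p-prime q-prime q∣p))

  -- Ensures that q does not divide k, so that n and n / k have the same valuation.
  ord<q : k < q
  ord<q = smaller (∃-order (prime≥2 q-prime) (prime∤⇒coprime q-prime q∤p))
    where
    smaller : ∃[ m ] 0 < m × m < q × ∃[ e ] p ^ m ≡ suc e × q ∣ e → k < q
    smaller (m , 0<m , m<q , e , p^m≡ , q∣e) =
      ℕ.≤-<-trans (minimal m 0<m (≡.subst (q ∣_) (≡.cong ℕ.pred (≡.sym p^m≡)) q∣e)) m<q

  split : ∀ m n → p ^ (m + n) ∸ 1 ≡ (p ^ m ∸ 1) + p ^ m * (p ^ n ∸ 1)
  split m n = ≡.cong ℕ.pred (begin
    p ^ (m + n)                                      ≡⟨ ℕ.^-distribˡ-+-* p m n ⟩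
    p ^ m * p ^ n                                    ≡⟨ ≡.cong (p ^ m *_) (1+[p^n-1]≡p^n p-prime n) ⟨
    p ^ m * suc (p ^ n ∸ 1)                          ≡⟨ ℕ.*-suc (p ^ m) (p ^ n ∸ 1) ⟩
    p ^ m + p ^ m * (p ^ n ∸ 1)                      ≡⟨ ≡.cong (_+ p ^ m * (p ^ n ∸ 1)) (1+[p^n-1]≡p^n p-prime m) ⟨
    suc (p ^ m ∸ 1) + p ^ m * (p ^ n ∸ 1)            ∎)
    where open ≡.≡-Reasoning

  ord∣⇒ : ∀ {n} → k ∣ n → q ∣ p ^ n ∸ 1
  ord∣⇒ (divides zero    ≡.refl) = q ∣0
  ord∣⇒ (divides (suc u) ≡.refl) = ≡.subst (q ∣_) (≡.sym (split k (u * k)))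
    (∣m∣n⇒∣m+n q∣p^k-1 (∣n⇒∣m*n (p ^ k) (ord∣⇒ {u * k} (divides u ≡.refl))))

  ⇒ord∣ : ∀ {n} → q ∣ p ^ n ∸ 1 → k ∣ n
  ⇒ord∣ {n} q∣ = remainder (n ℕ.% k) (m%n<n n k) (m≡m%n+[m/n]*n n k)
    where
    remainder : ∀ r → r < k → n ≡ r + (n ℕ./ k) * k → k ∣ n
    remainder zero    _     n≡ = divides (n ℕ./ k) n≡
    remainder (suc r) 1+r<k n≡ = contradiction (minimal (suc r) (s≤s z≤n) q∣p^r-1) (ℕ.<⇒≱ 1+r<k)
      where
      v = (n ℕ./ k) * k
      q∣p^r-1 : q ∣ p ^ suc r ∸ 1
      q∣p^r-1 = coprime-divisor (coprime-^ (prime∤⇒coprime q-prime q∤p) v)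
        (∣m+n∣m⇒∣n
          (≡.subst (q ∣_) (≡.trans (≡.cong (λ j → p ^ j ∸ 1) (≡.trans n≡ (ℕ.+-comm (suc r) v))) (split v (suc r))) q∣)
          (ord∣⇒ (divides (n ℕ./ k) ≡.refl)))

  p^2n-1 : ∀ n → p ^ (2 * n) ∸ 1 ≡ (p ^ n ∸ 1) * suc (p ^ n)
  p^2n-1 n = begin
    p ^ (n + (n + 0)) ∸ 1                     ≡⟨ ≡.cong (λ m → p ^ (n + m) ∸ 1) (ℕ.+-identityʳ n) ⟩
    p ^ (n + n) ∸ 1                           ≡⟨ split n n ⟩
    (p ^ n ∸ 1) + p ^ n * (p ^ n ∸ 1)         ≡⟨⟩
    suc (p ^ n) * (p ^ n ∸ 1)                 ≡⟨ ℕ.*-comm (suc (p ^ n)) (p ^ n ∸ 1) ⟩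
    (p ^ n ∸ 1) * suc (p ^ n)                 ∎
    where open ≡.≡-Reasoning

  ∣p^n+1⇒ : ∀ {n} → q ∣ suc (p ^ n) → k ∣ 2 * n × ¬ k ∣ n
  ∣p^n+1⇒ {n} q∣ = ⇒ord∣ (≡.subst (q ∣_) (≡.sym (p^2n-1 n)) (∣n⇒∣m*n (p ^ n ∸ 1) q∣)) ,
    -- pⁿ + 1 = (pⁿ - 1) + 2, so q would divide 2.
    λ k∣n → q∤2 (∣m+n∣m⇒∣n
      (≡.subst (q ∣_) (≡.trans (≡.cong suc (≡.sym (1+[p^n-1]≡p^n p-prime n))) (ℕ.+-comm 2 _)) q∣) (ord∣⇒ k∣n))

  module _ μ (vμ : IsValuation q (p ^ k ∸ 1) μ) where

    -- Write n = uk and lift the exponent from base pᵏ = 1 + (pᵏ - 1) to its u-th power.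
    valuation-p^n-1 : ∀ {n} ν → IsValuation q n ν → k ∣ n → IsValuation q (p ^ n ∸ 1) (μ + ν)
    valuation-p^n-1 {n} ν vn (divides u ≡.refl) = ≡.subst (λ x → IsValuation q (x ∸ 1) (μ + ν))
      (begin
        suc (p ^ k ∸ 1) ^ u      ≡⟨ ≡.cong (_^ u) (1+[p^n-1]≡p^n p-prime k) ⟩
        (p ^ k) ^ u              ≡⟨ ℕ.^-*-assoc p k u ⟩
        p ^ (k * u)              ≡⟨ ≡.cong (p ^_) (ℕ.*-comm k u) ⟩
        p ^ (u * k)              ∎)
      (lifting-the-exponent μ q∣p^k-1 vμ ν (valuation-*ˡ q-prime ν q∤k (≡.subst (λ x → IsValuation q x ν) (ℕ.*-comm u k) vn)))
      where
      open ≡.≡-Reasoning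
      q∤k : ¬ q ∣ k
      q∤k q∣k = ℕ.<⇒≱ ord<q (∣⇒≤ q∣k)

    -- In p²ⁿ - 1 = (pⁿ - 1)(pⁿ + 1) the first factor is prime to q, and doubling n does not affect
    -- its valuation at the odd prime q.
    valuation-p^n+1 : ∀ {n} ν → IsValuation q n ν → k ∣ 2 * n → ¬ k ∣ n → IsValuation q (suc (p ^ n)) (μ + ν)
    valuation-p^n+1 {n} ν vn k∣2n k∤n = valuation-*ˡ q-prime (μ + ν) (λ q∣ → k∤n (⇒ord∣ q∣))
      (≡.subst (λ x → IsValuation q x (μ + ν)) (p^2n-1 n)
        (valuation-p^n-1 {2 * n} ν (valuation-* q-prime 0 ν (∤⇒valuation-0 q-prime q∤2) vn) k∣2n))

-- Splitting off the prime powers of the qᵢ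

module _ {r} (q : Fin r → ℕ) (q-prime : ∀ i → Prime (q i)) (q-injective : Injective _≡_ _≡_ q) (e : Fin r → ℕ) where

  private
    prime-powers-coprime : ∀ {i j} → i ≢ j → Coprime (q i ^ e i) (q j ^ e j)
    prime-powers-coprime {i} {j} i≢j = coprime-^ (Coprimality.sym (coprime-^ (prime∤⇒coprime (q-prime j)
      (λ qj∣qi → i≢j (q-injective (≡.sym (prime∣prime⇒≡ (q-prime i) (q-prime j) qj∣qi))))) (e i))) (e j)

  ∏-∣ : ∀ {x} L → Propositional.Unique L → All (λ i → q i ^ e i ∣ x) L → product (map (λ i → q i ^ e i) L) ∣ x
  ∏-∣ []      _            _            = 1∣ _
  ∏-∣ (i ∷ L) (i∉ ∷ uniq) (∣x ∷ ∣xs) = coprime-∣-*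
    (coprime-product (All.map⁺ (All.map prime-powers-coprime i∉))) ∣x (∏-∣ L uniq ∣xs)

  -- The prime powers are pairwise coprime, so their product divides x. A further factor `q i` in
  -- the quotient would contradict the exactness of `e i`.
  cofactor : ∀ x (S : Subset r) → (∀ {i} → i ∈ S → IsValuation (q i) x (e i)) → (∀ {i} → i ∉ S → ¬ q i ∣ x) →
             ∃[ a ] x ≡ a * ∏[ S ] (λ i → q i ^ e i) × (∀ i → ¬ q i ∣ a)
  cofactor x S val non with ∏-∣ {x} (filter (_∈? S) (allFin r))
    (Uniqueₚ.filter⁺ (_∈? S) (Uniqueₚ.allFin⁺ r)) (All.map (proj₁ ∘ val) (All.all-filter (_∈? S) (allFin r)))
  ... | divides a x≡ = a , x≡ , q∤a
    where
    q∤a : ∀ i → ¬ q i ∣ a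
    q∤a i qi∣a with i ∈? S
    ... | no i∉S  = non i∉S (≡.subst (q i ∣_) (≡.sym x≡) (∣m⇒∣m*n _ qi∣a))
    ... | yes i∈S = proj₂ (val i∈S) (≡.subst (q i ^ suc (e i) ∣_) (≡.sym x≡)
      (*-pres-∣ qi∣a (∈⇒∣product (∈-map⁺ (λ i → q i ^ e i) (∈-filter⁺ (_∈? S) (∈-allFin i) i∈S)))))

module _ {r : ℕ} where

  subset : ∀ {ℓ} {P : Pred (Fin r) ℓ} → Decidable P → Subset r
  subset P? = Vec.tabulate (does ∘ P?)

  module _ {ℓ} {P : Pred (Fin r) ℓ} (P? : Decidable P) where

    ∈-subset⁻ : ∀ {i} → i ∈ subset P? → P i
    ∈-subset⁻ {i} i∈ with P? i | ≡.trans (≡.sym (lookup∘tabulate (does ∘ P?) i)) ([]=⇒lookup i∈)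
    ... | yes Pi | _  = Pi
    ... | no _   | ()

    ∈-subset⁺ : ∀ {i} → P i → i ∈ subset P?
    ∈-subset⁺ {i} Pi = lookup⇒[]= i _ (≡.trans (lookup∘tabulate (does ∘ P?) i) (dec-true (P? i) Pi))

  ∣Lcm : ∀ (f : Fin r → ℕ) i → f i ∣ Lcm f
  ∣Lcm f i = go (∈-tabulate⁺ i)
    where
    go : ∀ {x xs} → x Membershipₚ.∈ xs → x ∣ foldr lcm 1 xs
    go {xs = y ∷ ys} (here ≡.refl) = m∣lcm[m,n] y (foldr lcm 1 ys)
    go {xs = y ∷ ys} (there x∈ys)  = ∣-trans (go x∈ys) (n∣lcm[m,n] y (foldr lcm 1 ys))

-- Counting in lists

private variable
  ℓ₁ ℓ₂ ℓ₃ ℓ₄ : Level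

module Counting {a} {A : Set a} where

  count : ∀ {P : Pred A ℓ₁} → Decidable P → List A → ℕ
  count P? xs = length (filter P? xs)

  private
    indicator : ∀ {P : Set ℓ₁} → Dec P → ℕ
    indicator (yes _) = 1
    indicator (no  _) = 0

    count-∷ : ∀ {P : Pred A ℓ₁} (P? : Decidable P) x xs →
              count P? (x ∷ xs) ≡ indicator (P? x) + count P? xs
    count-∷ P? x xs with P? x
    ... | yes _ = ≡.refl
    ... | no  _ = ≡.refl

    indicator-∪ : ∀ {P : Set ℓ₁} {Q : Set ℓ₂} {R : Set ℓ₃} (P? : Dec P) (Q? : Dec Q) (R? : Dec R) →
                  (R → P ⊎ Q) → indicator R? ≤ indicator P? + indicator Q?
    indicator-∪ (yes p) _       (yes r) _ = s≤s z≤n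
    indicator-∪ (no ¬p) (yes q) (yes r) _ = s≤s z≤n
    indicator-∪ (no ¬p) (no ¬q) (yes r) f = contradiction (f r) [ ¬p , ¬q ]′
    indicator-∪ _       _       (no _)  _ = z≤n

    indicator-∪-∩ : ∀ {P : Set ℓ₁} {Q : Set ℓ₂} {R : Set ℓ₃} {S : Set ℓ₄}
      (P? : Dec P) (Q? : Dec Q) (R? : Dec R) (S? : Dec S) →
      (P → R) → (Q → R) → (P → Q → S) → indicator P? + indicator Q? ≤ indicator R? + indicator S?
    indicator-∪-∩ (yes p) _       (no ¬r) _       f g h = contradiction (f p) ¬r
    indicator-∪-∩ (no ¬p) (yes q) (no ¬r) _       f g h = contradiction (g q) ¬r
    indicator-∪-∩ (yes p) (yes q) (yes r) (no ¬s) f g h = contradiction (h p q) ¬s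
    indicator-∪-∩ (yes p) (yes q) (yes r) (yes s) f g h = ℕ.≤-refl
    indicator-∪-∩ (yes p) (no ¬q) (yes r) _       f g h = s≤s z≤n
    indicator-∪-∩ (no ¬p) (yes q) (yes r) _       f g h = s≤s z≤n
    indicator-∪-∩ (no ¬p) (no ¬q) _       _       f g h = z≤n

  module _ {P : Pred A ℓ₁} {Q : Pred A ℓ₂} {R : Pred A ℓ₃}
           (P? : Decidable P) (Q? : Decidable Q) (R? : Decidable R) where

    count-∪ : (∀ {x} → R x → P x ⊎ Q x) → ∀ xs → count R? xs ≤ count P? xs + count Q? xs
    count-∪ R⊆ []       = z≤n
    count-∪ R⊆ (x ∷ xs) = begin
      count R? (x ∷ xs)                      ≡⟨ count-∷ R? x xs ⟩
      indicator (R? x) + count R? xs         ≤⟨ ℕ.+-mono-≤ (indicator-∪ (P? x) (Q? x) (R? x) R⊆) (count-∪ R⊆ xs) ⟩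
      iP + iQ + (p + q)                      ≡⟨ rearrange iP iQ p q ⟩
      iP + p + (iQ + q)                      ≡⟨ ≡.cong₂ _+_ (count-∷ P? x xs) (count-∷ Q? x xs) ⟨
      count P? (x ∷ xs) + count Q? (x ∷ xs)  ∎
      where
      open ℕ.≤-Reasoning
      iP = indicator (P? x)
      iQ = indicator (Q? x)
      p = count P? xs
      q = count Q? xs
      rearrange : ∀ a b c d → a + b + (c + d) ≡ a + c + (b + d)
      rearrange = solve-∀

    count-∪-∩ : ∀ {S : Pred A ℓ₄} (S? : Decidable S) →
      (∀ {x} → P x → R x) → (∀ {x} → Q x → R x) → (∀ {x} → P x → Q x → S x) →
      ∀ xs → count P? xs + count Q? xs ≤ count R? xs + count S? xs
    count-∪-∩ S? P⊆R Q⊆R P∩Q⊆S []       = z≤n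
    count-∪-∩ S? P⊆R Q⊆R P∩Q⊆S (x ∷ xs) = begin
      count P? (x ∷ xs) + count Q? (x ∷ xs)  ≡⟨ ≡.cong₂ _+_ (count-∷ P? x xs) (count-∷ Q? x xs) ⟩
      iP + p + (iQ + q)        ≡⟨ rearrange iP iQ p q ⟩
      iP + iQ + (p + q)        ≤⟨ ℕ.+-mono-≤ (indicator-∪-∩ (P? x) (Q? x) (R? x) (S? x) P⊆R Q⊆R P∩Q⊆S)
                                             (count-∪-∩ S? P⊆R Q⊆R P∩Q⊆S xs) ⟩
      iR + iS + (r + s)        ≡⟨ rearrange iR iS r s ⟨
      iR + r + (iS + s)        ≡⟨ ≡.cong₂ _+_ (count-∷ R? x xs) (count-∷ S? x xs) ⟨
      count R? (x ∷ xs) + count S? (x ∷ xs)  ∎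
      where
      open ℕ.≤-Reasoning
      iP = indicator (P? x)
      iQ = indicator (Q? x)
      iR = indicator (R? x)
      iS = indicator (S? x)
      p = count P? xs
      q = count Q? xs
      r = count R? xs
      s = count S? xs
      rearrange : ∀ a b c d → a + c + (b + d) ≡ a + b + (c + d)
      rearrange = solve-∀

  count-⊆ : ∀ {P : Pred A ℓ₁} {Q : Pred A ℓ₂} (P? : Decidable P) (Q? : Decidable Q) →
            (∀ {x} → P x → Q x) → ∀ xs → count P? xs ≤ count Q? xs
  count-⊆ P? Q? P⊆Q []       = z≤n
  count-⊆ P? Q? P⊆Q (x ∷ xs) with P? x | Q? x
  ... | yes p | yes q = s≤s (count-⊆ P? Q? P⊆Q xs)
  ... | yes p | no ¬q = contradiction (P⊆Q p) ¬q
  ... | no ¬p | yes q = ℕ.m≤n⇒m≤1+n (count-⊆ P? Q? P⊆Q xs)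
  ... | no ¬p | no ¬q = count-⊆ P? Q? P⊆Q xs

  -- A union bound: with `R x y` saying that y is the image of x, it bounds a preimage by the sizes
  -- of the fibres.
  count-Any : ∀ {B : Set ℓ₂} {R : A → B → Set ℓ₁} (R? : ∀ x y → Dec (R x y)) k xs →
    (∀ y → count (λ x → R? x y) xs ≤ k) → ∀ ys → count (λ x → any? (R? x) ys) xs ≤ length ys * k
  count-Any R? k xs bound []       = ℕ.≤-reflexive (≡.cong length
    (List.filter-none (λ x → any? (R? x) []) {xs} (All.universal (λ _ ()) xs)))
  count-Any R? k xs bound (y ∷ ys) = ℕ.≤-trans
    (count-∪ (λ x → R? x y) (λ x → any? (R? x) ys) (λ x → any? (R? x) (y ∷ ys)) Any.toSum xs)
    (ℕ.+-mono-≤ (bound y) (count-Any R? k xs bound ys))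

-- N = M + 1; eM, eP, a and b count the solutions of Tₘ = 2 for m = N − 1, N + 1, A and B; k = #Per.
module DensityBounds {M QI QJ A B k eM eP a b : ℕ}
  (M≡ : M ≡ A * QI) (M+2≡ : suc (suc M) ≡ B * QJ)
  (cover : suc M ≤ eM + eP) (2eM : 2 * eM ≤ 2 + M) (2eP : 2 * eP ≤ 2 + suc (suc M))
  (fibre₁ : eM ≤ a * QI) (fibre₂ : eP ≤ b * QJ)
  (2a : 2 * a ≤ 2 + A) (2b : 2 * b ≤ 2 + B)
  (upper : k ≤ a + b) (lower : a + b ≤ k + 2) where

  open ℕ.≤-Reasoning

  -- One constant for both directions. Above, 4 comes from the two constants 2 in `2a` and `2b`, and
  -- the rest is padding; below, 4 comes from k + 2 and each 3 from `half₁` and `half₂`.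
  slack = 4 * (QI * QJ) + 3 * (QI + QJ)

  upperBound : 2 * QI * QJ * k ≤ (QI + QJ) * suc M + slack
  upperBound = begin
    2 * QI * QJ * k                                ≤⟨ ℕ.*-monoʳ-≤ (2 * QI * QJ) upper ⟩
    2 * QI * QJ * (a + b)                          ≡⟨ e₁ QI QJ a b ⟩
    QI * QJ * (2 * a + 2 * b)                      ≤⟨ ℕ.*-monoʳ-≤ (QI * QJ) (ℕ.+-mono-≤ 2a 2b) ⟩
    QI * QJ * (2 + A + (2 + B))                    ≡⟨ e₂ QI QJ A B ⟩
    4 * (QI * QJ) + QJ * (A * QI) + QI * (B * QJ)  ≡⟨ ≡.cong₂ (λ u v → 4 * (QI * QJ) + QJ * u + QI * v) M≡ M+2≡ ⟨
    4 * (QI * QJ) + QJ * M + QI * (suc (suc M))    ≤⟨ ℕ.m≤m+n _ (2 * QI + 4 * QJ) ⟩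
    4 * (QI * QJ) + QJ * M + QI * (suc (suc M)) + (2 * QI + 4 * QJ) ≡⟨ e₃ QI QJ M ⟩
    (QI + QJ) * suc M + slack                      ∎
    where
    e₁ : ∀ QI QJ a b → 2 * QI * QJ * (a + b) ≡ QI * QJ * (2 * a + 2 * b)
    e₁ = solve-∀
    e₂ : ∀ QI QJ A B → QI * QJ * (2 + A + (2 + B)) ≡ 4 * (QI * QJ) + QJ * (A * QI) + QI * (B * QJ)
    e₂ = solve-∀
    e₃ : ∀ QI QJ M → 4 * (QI * QJ) + QJ * M + QI * (suc (suc M)) + (2 * QI + 4 * QJ) ≡
                     (QI + QJ) * suc M + (4 * (QI * QJ) + 3 * (QI + QJ))
    e₃ = solve-∀

  -- The solutions for N + 1 fill at most about half of the field, so those for N - 1 must cover the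
  -- rest.
  half₁ : suc M ≤ 2 * (a * QI) + 3
  half₁ = ℕ.+-cancelˡ-≤ (suc M) _ _ (begin
    suc M + suc M                     ≡⟨ e₁ M ⟩
    2 * suc M                         ≤⟨ ℕ.*-monoʳ-≤ 2 cover ⟩
    2 * (eM + eP)                     ≡⟨ ℕ.*-distribˡ-+ 2 eM eP ⟩
    2 * eM + 2 * eP                   ≤⟨ ℕ.+-mono-≤ (ℕ.*-monoʳ-≤ 2 fibre₁) 2eP ⟩
    2 * (a * QI) + (2 + suc (suc M))  ≡⟨ e₂ (a * QI) M ⟩
    suc M + (2 * (a * QI) + 3)        ∎)
    where
    e₁ : ∀ M → suc M + suc M ≡ 2 * suc M
    e₁ = solve-∀
    e₂ : ∀ c M → 2 * c + (2 + suc (suc M)) ≡ suc M + (2 * c + 3)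
    e₂ = solve-∀

  half₂ : suc M ≤ 2 * (b * QJ) + 3
  half₂ = ℕ.+-cancelˡ-≤ (suc M) _ _ (begin
    suc M + suc M                     ≡⟨ e₁ M ⟩
    2 * suc M                         ≤⟨ ℕ.*-monoʳ-≤ 2 cover ⟩
    2 * (eM + eP)                     ≡⟨ ℕ.*-distribˡ-+ 2 eM eP ⟩
    2 * eM + 2 * eP                   ≤⟨ ℕ.+-mono-≤ 2eM (ℕ.*-monoʳ-≤ 2 fibre₂) ⟩
    -- Padding by 2 gives both halves the same constant 3.
    2 + M + 2 * (b * QJ)              ≤⟨ ℕ.m≤m+n _ 2 ⟩
    2 + M + 2 * (b * QJ) + 2          ≡⟨ e₂ (b * QJ) M ⟩
    suc M + (2 * (b * QJ) + 3)        ∎)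
    where
    e₁ : ∀ M → suc M + suc M ≡ 2 * suc M
    e₁ = solve-∀
    e₂ : ∀ c M → 2 + M + 2 * c + 2 ≡ suc M + (2 * c + 3)
    e₂ = solve-∀

  lowerBound : (QI + QJ) * suc M ≤ 2 * QI * QJ * k + slack
  lowerBound = begin
    (QI + QJ) * suc M                              ≡⟨ ℕ.*-distribʳ-+ (suc M) QI QJ ⟩
    QI * suc M + QJ * suc M                        ≤⟨ ℕ.+-mono-≤ (ℕ.*-monoʳ-≤ QI half₂) (ℕ.*-monoʳ-≤ QJ half₁) ⟩
    QI * (2 * (b * QJ) + 3) + QJ * (2 * (a * QI) + 3) ≡⟨ e₁ QI QJ a b ⟩
    2 * QI * QJ * (a + b) + 3 * (QI + QJ)          ≤⟨ ℕ.+-monoˡ-≤ _ (ℕ.*-monoʳ-≤ (2 * QI * QJ) lower) ⟩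
    2 * QI * QJ * (k + 2) + 3 * (QI + QJ)          ≡⟨ e₂ QI QJ k ⟩
    2 * QI * QJ * k + slack                        ∎
    where
    e₁ : ∀ QI QJ a b → QI * (2 * (b * QJ) + 3) + QJ * (2 * (a * QI) + 3) ≡ 2 * QI * QJ * (a + b) + 3 * (QI + QJ)
    e₁ = solve-∀
    e₂ : ∀ QI QJ k → 2 * QI * QJ * (k + 2) + 3 * (QI + QJ) ≡ 2 * QI * QJ * k + (4 * (QI * QJ) + 3 * (QI + QJ))
    e₂ = solve-∀

-- Periodic points over the field with pⁿ elements

module ChebyshevCount {c ℓ p n} (p-prime : Prime p) (F : FiniteField c ℓ (p ^ n)) where

  open FiniteField F
  open Field baseField using (Carrier; _≈_; setoid; refl; sym; trans)
  open Inverse enumeration using (to; from; to-cong; strictlyInverseˡ; strictlyInverseʳ)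
  open DecidableField baseField (_≈?_ F)
  open PrimePowerField {n = n} p-prime F
  open Counting {A = Carrier}
  open Membership setoid using () renaming (_∈_ to _∈ₗ_)
  open UniqueSetoid setoid using (Unique)
  open Endo setoid using () renaming (_^_ to _^^_)

  private
    N = p ^ n
    _≟_ = _≈?_ F

  elements : List Carrier
  elements = map from (allFin N)

  elements-unique : Unique elements
  elements-unique = Unique.map⁺ (≡.setoid (Fin N)) setoid
    (λ {i} {j} eq → ≡.trans (≡.sym (strictlyInverseˡ i)) (≡.trans (to-cong eq) (strictlyInverseˡ j)))
    (Uniqueₚ.allFin⁺ N)

  ∈-elements : ∀ x → x ∈ₗ elements
  ∈-elements x = Membershipₛ.∈-resp-≈ setoid (strictlyInverseʳ x)
    (Membershipₛ.∈-map⁺ (≡.setoid (Fin N)) setoid (λ { ≡.refl → refl }) (∈-allFin (to x)))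

  length-elements : length elements ≡ N
  length-elements = ≡.trans (List.length-map from (allFin N)) (List.length-tabulate id)

  # : ∀ {P : Pred Carrier ℓ₁} → Decidable P → ℕ
  # P? = count P? elements

  #-unique : ∀ {P : Pred Carrier ℓ₁} (P? : Decidable P) → Unique (filter P? elements) × All P (filter P? elements)
  #-unique P? = Unique.filter⁺ setoid P? elements-unique , All.all-filter P? elements

  T≈2? : ∀ m → Decidable (λ x → T m x ≈ two)
  T≈2? m x = T m x ≟ two

  E : ℕ → ℕ
  E m = # (T≈2? m)

  2E≤ : ∀ m → 0 < m → 2 * E m ≤ 2 + m
  2E≤ m 0<m = #T≈2≤ m 0<m _ (proj₁ (#-unique (T≈2? m))) (proj₂ (#-unique (T≈2? m)))

  -- T_d sends solutions for m * d to solutions for m, and each of its fibres has at most d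
  -- elements.
  E-* : ∀ m d → 0 < d → E (m * d) ≤ E m * d
  E-* m d 0<d = ℕ.≤-trans
    (count-⊆ (T≈2? (m * d)) (λ x → any? (λ y → T d x ≟ y) targets)
      (λ {x} eq → Membershipₛ.∈-filter⁺ setoid (T≈2? m)
        (λ x≈y eq′ → trans (T-cong m (sym x≈y)) eq′) (∈-elements (T d x)) (trans (sym (T-∘ m d x)) eq))
      elements)
    (count-Any (λ x y → T d x ≟ y) d elements
      (λ y → #T≈const≤ d 0<d y _ (proj₁ (#-unique (λ x → T d x ≟ y))) (proj₂ (#-unique (λ x → T d x ≟ y))))
      targets)
    where targets = filter (T≈2? m) elements

  module _ {M} (N≡ : N ≡ suc M) where

    T[N±1]≈2 : ∀ x → T M x ≈ two ⊎ T (suc (suc M)) x ≈ two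
    T[N±1]≈2 x = fixed⇒T≈2 M x (trans (T-index x (≡.sym N≡)) (T[pⁿ]≈id x))

    N≤E+E : suc M ≤ E M + E (suc (suc M))
    N≤E+E = ℕ.≤-trans (ℕ.≤-reflexive (≡.trans (≡.sym N≡) (≡.trans (≡.sym length-elements)
        (≡.cong length (≡.sym (List.filter-all true? {elements} (All.universal (λ _ → _) elements)))))))
      (count-∪ (T≈2? M) (T≈2? (suc (suc M))) true? (λ {x} _ → T[N±1]≈2 x) elements)
      where
      true? : Decidable {A = Carrier} (λ _ → ⊤)
      true? _ = yes _

    module _ {t} (0<t : 0 < t) where

      iterate : ∀ m x → (polyMap baseField (Chebyshev t) ^^ m) ⟨$⟩ x ≈ T (t ^ m) x
      iterate zero    x = sym (T₁≈id x)
      iterate (suc m) x = trans (iterate m (T t x)) (trans (sym (T-∘ (t ^ m) t x))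
        (T-index x (ℕ.*-comm (t ^ m) t)))

      module _ {A B QI QJ} (M≡ : M ≡ A * QI) (M+2≡ : suc (suc M) ≡ B * QJ)
        (A⊥t : Coprime A t) (B⊥t : Coprime B t)
        (⊥QI : ∀ {g} → Coprime g t → Coprime g QI) (⊥QJ : ∀ {g} → Coprime g t → Coprime g QJ)
        (0<M : 0 < M) where

        private
          positive-A-QI : 0 < A × 0 < QI
          positive-A-QI = *-positive⁻¹ A QI (≡.subst (0 <_) M≡ 0<M)
          positive-B-QJ : 0 < B × 0 < QJ
          positive-B-QJ = *-positive⁻¹ B QJ (≡.subst (0 <_) M+2≡ (s≤s z≤n))
          0<A  = proj₁ positive-A-QI
          0<QI = proj₂ positive-A-QI
          0<B  = proj₁ positive-B-QJ
          0<QJ = proj₂ positive-B-QJ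

        -- gcd(u, v) divides v, so it is prime to t and hence to Q; as it also divides u = C * Q, it
        -- divides C.
        T≈2-coprimePart : ∀ C {u Q} → u ≡ C * Q → (∀ {g} → Coprime g t → Coprime g Q) →
          ∀ {v} → Coprime v t → ∀ x → T u x ≈ two → T v x ≈ two → T C x ≈ two
        T≈2-coprimePart C {u} {Q} u≡ ⊥Q {v} v⊥t x eqᵘ eqᵛ = T≈2-∣ x g∣C (T≈2-gcd u v x eqᵘ eqᵛ)
          where
          g∣C : gcd u v ∣ C
          g∣C = coprime-divisor (⊥Q (λ (d∣g , d∣t) → v⊥t (∣-trans d∣g (gcd[m,n]∣n u v) , d∣t)))
            (≡.subst (gcd u v ∣_) (≡.trans u≡ (ℕ.*-comm C Q)) (gcd[m,n]∣m u v))

        -- A period m > 0 gives Tₛ(x) = 2 for s = tᵐ - 1 or s = tᵐ + 1, and both indices are prime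
        -- to t. Either one is combined with N - 1 or N + 1, whichever x satisfies.
        periodic⇒ : ∀ {x} → Per baseField (Chebyshev t) x → T A x ≈ two ⊎ T B x ≈ two
        periodic⇒ {x} (m , 0<m , eq) = go (t ^ m) ≡.refl (ℕ.m^n>0 t {{ℕ.>-nonZero 0<t}} m)
          where
          t∣ : ∀ {m} → 0 < m → t ∣ t ^ m
          t∣ {suc m} _ = m∣m*n (t ^ m)
          go : ∀ s → t ^ m ≡ s → 0 < s → T A x ≈ two ⊎ T B x ≈ two
          go (suc s) t^m≡ _ = [ case A M≡ ⊥QI inj₁ , case B M+2≡ ⊥QJ inj₂ ]′ (T[N±1]≈2 x)
            where
            d∣1+s : ∀ {d} → d ∣ t → d ∣ suc s
            d∣1+s d∣t = ∣-trans d∣t (≡.subst (t ∣_) t^m≡ (t∣ 0<m))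
            s⊥t : Coprime s t
            s⊥t {d} (d∣s , d∣t) = ∣1⇒≡1 (∣m+n∣m⇒∣n (≡.subst (d ∣_) (≡.sym (ℕ.+-comm s 1)) (d∣1+s d∣t)) d∣s)
            s+2⊥t : Coprime (suc (suc s)) t
            s+2⊥t {d} (d∣s+2 , d∣t) = ∣1⇒≡1 (∣m+n∣m⇒∣n (≡.subst (d ∣_) (≡.cong suc (ℕ.+-comm 1 s)) d∣s+2) (d∣1+s d∣t))
            case : ∀ C {u Q} → u ≡ C * Q → (∀ {g} → Coprime g t → Coprime g Q) →
                   (T C x ≈ two → T A x ≈ two ⊎ T B x ≈ two) → T u x ≈ two → T A x ≈ two ⊎ T B x ≈ two
            case C u≡ ⊥Q inj eqᵘ = inj ([ T≈2-coprimePart C u≡ ⊥Q s⊥t x eqᵘ , T≈2-coprimePart C u≡ ⊥Q s+2⊥t x eqᵘ ]′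
              (fixed⇒T≈2 s x (trans (trans (T-index x (≡.sym t^m≡)) (sym (iterate m x))) eq)))

        -- Some m > 0 has tᵐ ≡ 1 modulo C. Then C divides tᵐ - 1, and the value 2 at that index
        -- makes the m-th iterate fix x.
        ⇒periodic : ∀ {C} → 0 < C → Coprime C t → ∀ {x} → T C x ≈ two → Per baseField (Chebyshev t) x
        ⇒periodic 0<C C⊥t {x} eq with ∃-power≡1 0<C 0<t C⊥t
        ... | m , 0<m , e , t^m≡ , C∣e = m , 0<m ,
          trans (iterate m x) (trans (T-index x t^m≡) (T≈2⇒fixed e x (inj₁ (T≈2-∣ x C∣e eq))))

        -- A and B divide N - 1 and N + 1, which differ by 2. The overlap thus has at most two
        -- points, the constant in k + 2.
        common-solution : ∀ {x} → T A x ≈ two → T B x ≈ two → T 2 x ≈ two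
        common-solution {x} eqᴬ eqᴮ = T≈2-∸ M 2 x
          (T≈2-∣ x (divides QI (≡.trans M≡ (ℕ.*-comm A QI))) eqᴬ)
          (T≈2-∣ x (divides QJ (≡.trans (ℕ.+-comm M 2) (≡.trans M+2≡ (ℕ.*-comm B QJ)))) eqᴮ)

        #Per-bounds : 2 * QI * QJ * #Per F (Chebyshev t) ≤ (QI + QJ) * suc M + (4 * (QI * QJ) + 3 * (QI + QJ)) ×
                      (QI + QJ) * suc M ≤ 2 * QI * QJ * #Per F (Chebyshev t) + (4 * (QI * QJ) + 3 * (QI + QJ))
        #Per-bounds = upperBound , lowerBound
          where
          Per?ₜ = Per? F (Chebyshev t)
          E₂≤2 : E 2 ≤ 2
          E₂≤2 = ℕ.*-cancelˡ-≤ 2 (2E≤ 2 (s≤s z≤n))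
          open DensityBounds {M} {QI} {QJ} {A} {B} {#Per F (Chebyshev t)} {E M} {E (suc (suc M))} {E A} {E B}
            M≡ M+2≡ N≤E+E (2E≤ M 0<M) (2E≤ (suc (suc M)) (s≤s z≤n))
            (≡.subst (λ u → E u ≤ E A * QI) (≡.sym M≡) (E-* A QI 0<QI))
            (≡.subst (λ u → E u ≤ E B * QJ) (≡.sym M+2≡) (E-* B QJ 0<QJ))
            (2E≤ A 0<A) (2E≤ B 0<B)
            (count-∪ (T≈2? A) (T≈2? B) Per?ₜ periodic⇒ elements)
            (ℕ.≤-trans (count-∪-∩ (T≈2? A) (T≈2? B) Per?ₜ (T≈2? 2)
               (⇒periodic 0<A A⊥t) (⇒periodic 0<B B⊥t) common-solution elements)
              (ℕ.+-monoʳ-≤ (#Per F (Chebyshev t)) E₂≤2))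

-- From integer inequalities to a rational limit

∣⊖∣≤ : ∀ m n {c} → m ≤ n + c → n ≤ m + c → ℤ.∣ m ℤ.⊖ n ∣ ≤ c
∣⊖∣≤ m n {c} m≤ n≤ with ℕ.≤-total m n
... | inj₁ m≤n = ℕ.≤-trans (ℕ.≤-reflexive (ℤ.∣⊖∣-≤ m≤n)) (ℕ.m≤n+o⇒m∸n≤o n m n≤)
... | inj₂ n≤m = ℕ.≤-trans (ℕ.≤-reflexive (≡.trans (ℤ.∣m⊖n∣≡∣n⊖m∣ m n) (ℤ.∣⊖∣-≤ n≤m))) (ℕ.m≤n+o⇒m∸n≤o m n m≤)

-- The difference is |Dk - sN| / (ND) ≤ c / N. As the numerator of ε is at least 1, it suffices that
-- N exceeds c times its denominator, whatever k, s and D are.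
∣k/N-s/D∣<ε : ∀ ε → 0ℚ ℚ.< ε → ∀ c → ∃[ N₀ ] (∀ {N D} .{{_ : NonZero N}} .{{_ : NonZero D}} k s → N₀ < N →
              D * k ≤ s * N + c → s * N ≤ D * k + c → ℚ.∣ (+ k / N) ℚ.- (+ s / D) ∣ ℚ.< ε)
∣k/N-s/D∣<ε ε 0<ε c with ε | ℚ.positive 0<ε
... | mkℚ (+ suc e) d-1 coprime | _ = c * suc d-1 , λ {N} {D} k s → bound N D k s
  where
  ε′ = mkℚ (+ suc e) d-1 coprime
  bound : ∀ N D .{{_ : NonZero N}} .{{_ : NonZero D}} k s → c * suc d-1 < N →
          D * k ≤ s * N + c → s * N ≤ D * k + c → ℚ.∣ (+ k / N) ℚ.- (+ s / D) ∣ ℚ.< ε′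
  bound (suc N-1) (suc D-1) k s cd<N Dk≤ sN≤ = ℚ.toℚᵘ-cancel-< (ℚᵘ.<-respˡ-≃ (ℚᵘ.≃-sym value) unnormalised)
    where
    N = suc N-1
    D = suc D-1
    x = mkℚᵘ (+ k) N-1
    y = mkℚᵘ (+ s) D-1
    -- Without reduction to lowest terms the difference is literally `gap` over `N * D`, and the
    -- comparison with ε is a cross multiplication.
    value : toℚᵘ ℚ.∣ (+ k / N) ℚ.- (+ s / D) ∣ ℚᵘ.≃ ℚᵘ.∣ x ℚᵘ.- y ∣
    value = begin
      toℚᵘ ℚ.∣ fromℚᵘ x ℚ.- fromℚᵘ y ∣                       ≈⟨ ℚ.toℚᵘ-homo-∣-∣ (fromℚᵘ x ℚ.- fromℚᵘ y) ⟩
      ℚᵘ.∣ toℚᵘ (fromℚᵘ x ℚ.- fromℚᵘ y) ∣                    ≈⟨ ℚᵘ.∣-∣-cong (ℚ.toℚᵘ-homo-+ (fromℚᵘ x) (ℚ.- fromℚᵘ y)) ⟩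
      ℚᵘ.∣ toℚᵘ (fromℚᵘ x) ℚᵘ.+ toℚᵘ (ℚ.- fromℚᵘ y) ∣        ≈⟨ ℚᵘ.∣-∣-cong (ℚᵘ.+-cong (ℚ.toℚᵘ-fromℚᵘ x)
                                                                 (ℚᵘ.≃-trans (ℚ.toℚᵘ-homo‿- (fromℚᵘ y)) (ℚᵘ.-‿cong (ℚ.toℚᵘ-fromℚᵘ y)))) ⟩
      ℚᵘ.∣ x ℚᵘ.- y ∣                                        ∎
      where open import Relation.Binary.Reasoning.Setoid ℚᵘ.≃-setoid

    gap : ℕ
    gap = ℤ.∣ + k ℤ.* + D ℤ.+ (ℤ.- + s) ℤ.* + N ∣

    gap≤c : gap ≤ c
    gap≤c = ≡.subst (λ i → ℤ.∣ i ∣ ≤ c) (≡.sym (begin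
      + k ℤ.* + D ℤ.+ (ℤ.- + s) ℤ.* + N        ≡⟨ ≡.cong₂ ℤ._+_ (ℤ.pos-* k D) (ℤ.neg-distribˡ-* (+ s) (+ N)) ⟨
      + (k * D) ℤ.+ ℤ.- (+ s ℤ.* + N)          ≡⟨ ≡.cong (λ i → + (k * D) ℤ.+ ℤ.- i) (ℤ.pos-* s N) ⟨
      + (k * D) ℤ.+ ℤ.- (+ (s * N))            ≡⟨ ℤ.m-n≡m⊖n (k * D) (s * N) ⟩
      k * D ℤ.⊖ s * N                          ∎))
      (∣⊖∣≤ (k * D) (s * N) (≡.subst (_≤ s * N + c) (ℕ.*-comm D k) Dk≤) (≡.subst (λ i → s * N ≤ i + c) (ℕ.*-comm D k) sN≤))
      where open ≡.≡-Reasoning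

    unnormalised : ℚᵘ.∣ x ℚᵘ.- y ∣ ℚᵘ.< mkℚᵘ (+ suc e) d-1
    unnormalised = ℚᵘ.*<* (≡.subst₂ ℤ._<_ (ℤ.pos-* gap (suc d-1)) (ℤ.pos-* (suc e) (N * D)) (ℤ.+<+ (begin-strict
      gap * suc d-1                                      ≤⟨ ℕ.*-monoˡ-≤ (suc d-1) gap≤c ⟩
      c * suc d-1                                        <⟨ cd<N ⟩
      N                                                  ≤⟨ ℕ.m≤m*n N D ⟩
      N * D                                              ≤⟨ ℕ.m≤n*m (N * D) (suc e) ⟩
      suc e * (N * D)                                    ∎)))
      where open ℕ.≤-Reasoning

theorem5p8 : ∀ {c ℓ} (r : ℕ) → 2 ≤ r →
    (q f : Fin r → ℕ) (q-prime : ∀ i → Prime (q i)) → (∀ i → ¬ (2 ∣ q i)) →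
    Injective _≡_ _≡_ q → (∀ i → 1 ≤ f i) →
    (t : ℕ) → t ≡ ∏ (λ i → q i ^ f i) →
    (p : ℕ) → Prime p → (∀ i → p ≢ q i) →
    (ord μ : Fin r → ℕ) → (∀ i → IsOrd (q i) p (ord i)) →
    (∀ i → IsValuation (q i) (p ^ ord i ∸ 1) (μ i)) →
    (Δ : ℕ) → Δ ≡ Lcm ord →
    (δ : ℕ) → 0 < δ → (ν : Fin r → ℕ) →
    let Condition : ℕ → Set
        Condition n = gcd Δ n ≡ δ × (∀ i → IsValuation (q i) n (ν i))
        Q : Subset r → ℕ
        Q S = ∏[ S ] (λ i → q i ^ (μ i + ν i))
    in
    Inf Condition →
    ∃[ I ] ∃[ J ] Empty (I ∩ J) ×
      ((𝔽 : ∀ n → .{{NonZero n}} → FiniteField c ℓ (p ^ n)) →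
        LimitAlong Condition (λ n → perDensity (𝔽 n) (Chebyshev t))
          (_/_ (+ (Q I + Q J)) (2 * Q I * Q J) {{mean-denominator≢0 q-prime I J (λ i → μ i + ν i)}}))
theorem5p8 {c} {ℓ} r _ q f q-prime q-odd q-injective f≥1 t t≡ p p-prime p≢q ord μ isOrd vμ Δ Δ≡ δ _ ν _ =
  I , J , disjoint , λ 𝔽 ε 0<ε → let N₀ , close = ∣k/N-s/D∣<ε ε 0<ε slack in
    N₀ , λ n N₀≤n condition →
      let upper , lower = #Per-bound n (𝔽 n) condition in
      close {{p^n≢0 n}} {{mean-denominator≢0 q-prime I J e}}
        (#Per (𝔽 n) (Chebyshev t)) (Q I + Q J) (ℕ.≤-<-trans N₀≤n (n<p^n (prime≥2 p-prime) n)) upper lower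
  where
  e : Fin r → ℕ
  e i = μ i + ν i

  Q : Subset r → ℕ
  Q S = ∏[ S ] (λ i → q i ^ e i)

  p^n≢0 : ∀ n → NonZero (p ^ n)
  p^n≢0 n = ℕ.m^n≢0 p n {{prime⇒nonZero p-prime}}

  -- Only δ occurs, so I and J are fixed before n varies. As `ord i` divides Δ and gcd(Δ, n) = δ,
  -- membership in I means qᵢ ∣ N - 1 and membership in J means qᵢ ∣ N + 1.
  I? = λ i → ord i ∣? δ
  J? = λ i → (ord i ∣? 2 * δ) ×-dec ¬? (ord i ∣? δ)

  I J : Subset r
  I = subset I?
  J = subset J?

  -- The same for all admissible n, so the error disappears in the limit.
  slack : ℕ
  slack = 4 * (Q I * Q J) + 3 * (Q I + Q J)

  disjoint : Empty (I ∩ J)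
  disjoint (i , i∈I∩J) = let i∈I , i∈J = x∈p∩q⁻ I J i∈I∩J in
    proj₂ (∈-subset⁻ J? i∈J) (∈-subset⁻ I? i∈I)

  q∣t : ∀ i → q i ∣ t
  q∣t i = ≡.subst (q i ∣_) (≡.sym t≡) (∣-trans (q∣q^ (f≥1 i)) (∈⇒∣product (∈-tabulate⁺ i)))
    where
    q∣q^ : ∀ {k} → 1 ≤ k → q i ∣ q i ^ k
    q∣q^ {suc k} _ = m∣m*n (q i ^ k)

  ∤⇒coprime-t : ∀ {a} → (∀ i → ¬ q i ∣ a) → Coprime a t
  ∤⇒coprime-t {a} q∤a = ≡.subst (Coprime a) (≡.sym t≡) (coprime-product (All.tabulate⁺ λ i →
    coprime-^ (Coprimality.sym (prime∤⇒coprime (q-prime i) (q∤a i))) (f i)))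

  coprime-t⇒coprime-Q : ∀ S {g} → Coprime g t → Coprime g (Q S)
  coprime-t⇒coprime-Q S {g} g⊥t = coprime-product (All.map⁺ (All.universal
    {P = λ i → Coprime g (q i ^ e i)} (λ i → coprime-^ (g⊥q i) (e i)) (filter (_∈? S) (allFin r))))
    where
    g⊥q : ∀ i → Coprime g (q i)
    g⊥q i (d∣g , d∣q) = g⊥t (d∣g , ∣-trans d∣q (q∣t i))

  0<t : 0 < t
  0<t = ≡.subst (0 <_) (≡.sym t≡) (ℕ.>-nonZero⁻¹ _ {{product≢0 (All.tabulate⁺ λ i →
    ℕ.m^n≢0 (q i) (f i) {{prime⇒nonZero (q-prime i)}})}})

  module _ (n : ℕ) (condition : gcd Δ n ≡ δ × (∀ i → IsValuation (q i) n (ν i))) where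

    gcd≡δ = proj₁ condition
    vν = proj₂ condition

    ord∣Δ : ∀ i → ord i ∣ Δ
    ord∣Δ i = ≡.subst (ord i ∣_) (≡.sym Δ≡) (∣Lcm ord i)

    ∣n⇒∣δ : ∀ i → ord i ∣ n → ord i ∣ δ
    ∣n⇒∣δ i ∣n = ≡.subst (ord i ∣_) gcd≡δ (gcd-greatest (ord∣Δ i) ∣n)

    δ∣n : δ ∣ n
    δ∣n = ≡.subst (_∣ n) gcd≡δ (gcd[m,n]∣n Δ n)

    -- `ord i` divides 2Δ as well as 2n, and gcd(2Δ, 2n) = 2δ.
    ∣2n⇒∣2δ : ∀ i → ord i ∣ 2 * n → ord i ∣ 2 * δ
    ∣2n⇒∣2δ i ∣2n = ≡.subst (ord i ∣_)
      (≡.trans (≡.sym (c*gcd[m,n]≡gcd[cm,cn] 2 Δ n)) (≡.cong (2 *_) gcd≡δ))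
      (gcd-greatest (∣n⇒∣m*n 2 (ord∣Δ i)) ∣2n)

    module Order i = MultiplicativeOrder (q-prime i) (q-odd i) p-prime (p≢q i) (isOrd i)

    p^n-1-cofactor : ∃[ a ] p ^ n ∸ 1 ≡ a * Q I × (∀ i → ¬ q i ∣ a)
    p^n-1-cofactor = cofactor q q-prime q-injective e (p ^ n ∸ 1) I
      (λ {i} i∈I → Order.valuation-p^n-1 i (μ i) (vμ i) (ν i) (vν i) (∣-trans (∈-subset⁻ I? i∈I) δ∣n))
      (λ {i} i∉I q∣ → i∉I (∈-subset⁺ I? (∣n⇒∣δ i (Order.⇒ord∣ i q∣))))

    p^n+1-cofactor : ∃[ b ] suc (p ^ n) ≡ b * Q J × (∀ i → ¬ q i ∣ b)
    p^n+1-cofactor = cofactor q q-prime q-injective e (suc (p ^ n)) J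
      (λ {i} i∈J → let ∣2δ , ∤δ = ∈-subset⁻ J? i∈J in
        Order.valuation-p^n+1 i (μ i) (vμ i) (ν i) (vν i) (∣-trans ∣2δ (*-monoʳ-∣ 2 δ∣n)) (λ ∣n → ∤δ (∣n⇒∣δ i ∣n)))
      (λ {i} i∉J q∣ → let ∣2n , ∤n = Order.∣p^n+1⇒ i q∣ in
        i∉J (∈-subset⁺ J? (∣2n⇒∣2δ i ∣2n , λ ∣δ → ∤n (∣-trans ∣δ δ∣n))))

  #Per-bound : ∀ n .{{_ : NonZero n}} (F : FiniteField c ℓ (p ^ n)) →
    gcd Δ n ≡ δ × (∀ i → IsValuation (q i) n (ν i)) →
    2 * Q I * Q J * #Per F (Chebyshev t) ≤ (Q I + Q J) * p ^ n + slack ×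
    (Q I + Q J) * p ^ n ≤ 2 * Q I * Q J * #Per F (Chebyshev t) + slack
  #Per-bound n F condition with a , a≡ , q∤a ← p^n-1-cofactor n condition
                              | b , b≡ , q∤b ← p^n+1-cofactor n condition =
    ≡.subst (λ N → 2 * Q I * Q J * #Per F (Chebyshev t) ≤ (Q I + Q J) * N + slack ×
                   (Q I + Q J) * N ≤ 2 * Q I * Q J * #Per F (Chebyshev t) + slack) (≡.sym N≡)
      (ChebyshevCount.#Per-bounds {n = n} p-prime F N≡ 0<t a≡ (≡.trans (≡.cong suc (≡.sym N≡)) b≡)
        (∤⇒coprime-t q∤a) (∤⇒coprime-t q∤b) (coprime-t⇒coprime-Q I) (coprime-t⇒coprime-Q J) 0<p^n-1)
    where
    N≡ : p ^ n ≡ suc (p ^ n ∸ 1)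
    N≡ = ≡.sym (1+[p^n-1]≡p^n p-prime n)
    0<p^n-1 : 0 < p ^ n ∸ 1
    0<p^n-1 = ℕ.m<n⇒0<n∸m (ℕ.≤-<-trans (ℕ.>-nonZero⁻¹ n) (n<p^n (prime≥2 p-prime) n))
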